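{- Let $m\ge n\ge 0$ and $M\ge 1$ be integers and let $\lambda$ be a partition inside an $n\times m$ board ($n$ rows, $m$ columns). Then $$X_\lambda^{m+n}(M)=X_\lambda^{m+n}(M-1)+x_M\sum_{i=1}^{m+n}q^{m+n-i-\lambda_i'}\,X^{m+n-1}_{\lambda/i}(M-1)+x_M^2\sum_{(i,j)\in\lambda}q^{\,i-1+(m+n-j-\lambda_j')}\,X^{m+n-2}_{\lambda/(i,j)}(M-1),$$ where $\lambda/(i,j)$ is the partition obtained from $\lambda$ by removing row $i$ and column $j$, and $\lambda/i$ is the partition obtained from $\lambda$ by removing column $i$ if $1\le i\le m$, or by removing row $m+n-i+1$ if $m+1\le i\le m+n$.
   Context: Boards and partitions: cell $(i,j)$ is in row $i$ from the top and column $j$ from the left. A partition $\lambda=(\lambda_1\ge\cdots\ge\lambda_n\ge 0)$ with $\lambda_1\le m$ is identified with the set of cells $(i,j)$ with $j\le\lambda_i$. $\lambda'_j$ is the number of cells in column $j$ of $\lambda$ (the conjugate partition), so $\lambda'_j=0$ for $j>\lambda_1$. Graph of $\lambda$: for $\lambda$ inside an $n\times m$ board and $N=m+n$, $G(\lambda)$ has vertices $1,\dots,N$; all pairs $a<b$ are edges except that each cell $(i,a)\in\lambda$ gives the non-edge $\{a,N+1-i\}$. (This depends only on $\lambda$ and $N$, and is the graph of the abelian Dyck path $\mathsf{n}^m w(\lambda)\mathsf{e}^n$.) Chromatic polynomial in $M$ variables: $X_\lambda^{N}(M)=\sum_\kappa q^{\mathrm{asc}(\kappa)}\prod_v x_{\kappa(v)}\in\mathbb{Z}[q][x_1,\dots,x_M]$,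 the sum over proper colorings $\kappa:\{1,\dots,N\}\to\{1,\dots,M\}$ of the graph $G(\lambda)$ on $N$ vertices, where $\mathrm{asc}(\kappa)$ is the number of edges $\{a,b\}$ with $a<b$ and $\kappa(a)<\kappa(b)$. For $N=0$ it equals $1$. -}

module Defs where

open import Algebra.Bundles using (CommutativeRing)
import Algebra.Properties.CommutativeMonoid.Sum as Sum
import Algebra.Properties.Semiring.Exp as Exp
import Algebra.Properties.Ring as RingProperties
import Algebra.Properties.CommutativeSemigroup as CommutativeSemigroupProperties
open import Data.Fin.Base as Fin using (Fin; zero; suc; toℕ; opposite; punchIn; splitAt)
open import Data.Fin.Properties using (all?; any?; toℕ<n; _≟_)
open import Data.Fin.Relation.Unary.Top using (view; ‵fromℕ; ‵inject₁)
open import Data.Integer.Properties using () renaming (+-*-commutativeRing to ℤ-commutativeRing)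
open import Data.List.Base
  using (List; []; _∷_; map; foldr; filter; length; allFin; cartesianProduct; cartesianProductWith)
open import Data.Nat.Base as ℕ using (ℕ; zero; suc; pred; _≤_; _<_)
open import Data.Nat.Properties as ℕ using (_<?_)
open import Data.Product.Base using (_×_; _,_; ∃; ∃₂)
open import Data.Sum.Base using (inj₁; inj₂)
open import Data.Vec.Base as Vec using (Vec; lookup)
open import Data.Vec.Functional using (Vector; removeAt)
open import Level using (0ℓ; _⊔_)
open import Relation.Binary.PropositionalEquality using (_≡_; _≢_)
import Relation.Binary.Reasoning.Setoid as SetoidReasoning
open import Relation.Nullary using (¬_; Dec; yes; no)
open import Relation.Nullary.Decidable using (¬?; _×-dec_; _→-dec_)

-- R[t].  A polynomial is its list of coefficients, constant term first; lists
-- may have trailing zeros, so equality is equality of all coefficients.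
module Polynomial {c ℓ} (R : CommutativeRing c ℓ) where

  open CommutativeRing R
  open RingProperties ring using (-0#≈0#)
  open CommutativeSemigroupProperties +-commutativeSemigroup using (interchange)
  open SetoidReasoning setoid

  Poly : Set c
  Poly = List Carrier

  coeff : Poly → ℕ → Carrier
  coeff []      _       = 0#
  coeff (a ∷ p) zero    = a
  coeff (a ∷ p) (suc k) = coeff p k

  infix 4 _≈ₚ_
  record _≈ₚ_ (p r : Poly) : Set ℓ where
    constructor coeffwise
    field at : ∀ k → coeff p k ≈ coeff r k
  open _≈ₚ_ public

  infixl 6 _+ₚ_
  infixl 7 _*ₚ_ _·_

  _+ₚ_ : Poly → Poly → Poly
  []      +ₚ r       = r
  (a ∷ p) +ₚ []      = a ∷ p
  (a ∷ p) +ₚ (b ∷ r) = a + b ∷ p +ₚ r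

  _·_ : Carrier → Poly → Poly
  a · p = map (a *_) p

  -ₚ_ : Poly → Poly
  -ₚ p = map -_ p

  _*ₚ_ : Poly → Poly → Poly
  []      *ₚ r = []
  (a ∷ p) *ₚ r = a · r +ₚ (0# ∷ p *ₚ r)

  const : Carrier → Poly
  const a = a ∷ []

  t : Poly
  t = 0# ∷ 1# ∷ []

  private
    coeff-+ : ∀ p r k → coeff (p +ₚ r) k ≈ coeff p k + coeff r k
    coeff-+ []      r       k       = sym (+-identityˡ _)
    coeff-+ (a ∷ p) []      k       = sym (+-identityʳ _)
    coeff-+ (a ∷ p) (b ∷ r) zero    = refl
    coeff-+ (a ∷ p) (b ∷ r) (suc k) = coeff-+ p r k

    coeff-· : ∀ a p k → coeff (a · p) k ≈ a * coeff p k
    coeff-· a []      k       = sym (zeroʳ a)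
    coeff-· a (b ∷ p) zero    = refl
    coeff-· a (b ∷ p) (suc k) = coeff-· a p k

    coeff-neg : ∀ p k → coeff (-ₚ p) k ≈ - coeff p k
    coeff-neg []      k       = sym -0#≈0#
    coeff-neg (b ∷ p) zero    = refl
    coeff-neg (b ∷ p) (suc k) = coeff-neg p k

    ≈ₚ-refl : ∀ {p} → p ≈ₚ p
    ≈ₚ-refl .at k = refl

    ≈ₚ-sym : ∀ {p r} → p ≈ₚ r → r ≈ₚ p
    ≈ₚ-sym e .at k = sym (e .at k)

    ≈ₚ-trans : ∀ {p r s} → p ≈ₚ r → r ≈ₚ s → p ≈ₚ s
    ≈ₚ-trans e f .at k = trans (e .at k) (f .at k)

    +ₚ-cong : ∀ {p p′ r r′} → p ≈ₚ p′ → r ≈ₚ r′ → p +ₚ r ≈ₚ p′ +ₚ r′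
    +ₚ-cong {p} {p′} {r} {r′} e f .at k = begin
      coeff (p +ₚ r) k        ≈⟨ coeff-+ p r k ⟩
      coeff p k + coeff r k   ≈⟨ +-cong (e .at k) (f .at k) ⟩
      coeff p′ k + coeff r′ k ≈⟨ coeff-+ p′ r′ k ⟨
      coeff (p′ +ₚ r′) k      ∎

    +ₚ-assoc : ∀ p r s → (p +ₚ r) +ₚ s ≈ₚ p +ₚ (r +ₚ s)
    +ₚ-assoc p r s .at k = begin
      coeff ((p +ₚ r) +ₚ s) k             ≈⟨ coeff-+ (p +ₚ r) s k ⟩
      coeff (p +ₚ r) k + coeff s k        ≈⟨ +-congʳ (coeff-+ p r k) ⟩
      coeff p k + coeff r k + coeff s k   ≈⟨ +-assoc _ _ _ ⟩
      coeff p k + (coeff r k + coeff s k) ≈⟨ +-congˡ (coeff-+ r s k) ⟨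
      coeff p k + coeff (r +ₚ s) k        ≈⟨ coeff-+ p (r +ₚ s) k ⟨
      coeff (p +ₚ (r +ₚ s)) k             ∎

    +ₚ-comm : ∀ p r → p +ₚ r ≈ₚ r +ₚ p
    +ₚ-comm p r .at k = begin
      coeff (p +ₚ r) k      ≈⟨ coeff-+ p r k ⟩
      coeff p k + coeff r k ≈⟨ +-comm _ _ ⟩
      coeff r k + coeff p k ≈⟨ coeff-+ r p k ⟨
      coeff (r +ₚ p) k      ∎

    +ₚ-identityʳ : ∀ p → p +ₚ [] ≈ₚ p
    +ₚ-identityʳ p = +ₚ-comm p []

    -ₚ-cong : ∀ {p r} → p ≈ₚ r → -ₚ p ≈ₚ -ₚ r
    -ₚ-cong {p} {r} e .at k = begin
      coeff (-ₚ p) k ≈⟨ coeff-neg p k ⟩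
      - coeff p k    ≈⟨ -‿cong (e .at k) ⟩
      - coeff r k    ≈⟨ coeff-neg r k ⟨
      coeff (-ₚ r) k ∎

    -ₚ-inverseˡ : ∀ p → -ₚ p +ₚ p ≈ₚ []
    -ₚ-inverseˡ p .at k = begin
      coeff (-ₚ p +ₚ p) k        ≈⟨ coeff-+ (-ₚ p) p k ⟩
      coeff (-ₚ p) k + coeff p k ≈⟨ +-congʳ (coeff-neg p k) ⟩
      - coeff p k + coeff p k    ≈⟨ -‿inverseˡ _ ⟩
      0#                         ∎

    ·-cong : ∀ {a b p r} → a ≈ b → p ≈ₚ r → a · p ≈ₚ b · r
    ·-cong {a} {b} {p} {r} e f .at k = begin
      coeff (a · p) k ≈⟨ coeff-· a p k ⟩
      a * coeff p k   ≈⟨ *-cong e (f .at k) ⟩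
      b * coeff r k   ≈⟨ coeff-· b r k ⟨
      coeff (b · r) k ∎

    ·-distrib : ∀ a p r → a · (p +ₚ r) ≈ₚ a · p +ₚ a · r
    ·-distrib a p r .at k = begin
      coeff (a · (p +ₚ r)) k              ≈⟨ coeff-· a (p +ₚ r) k ⟩
      a * coeff (p +ₚ r) k                ≈⟨ *-congˡ (coeff-+ p r k) ⟩
      a * (coeff p k + coeff r k)         ≈⟨ distribˡ _ _ _ ⟩
      a * coeff p k + a * coeff r k       ≈⟨ +-cong (coeff-· a p k) (coeff-· a r k) ⟨
      coeff (a · p) k + coeff (a · r) k   ≈⟨ coeff-+ (a · p) (a · r) k ⟨
      coeff (a · p +ₚ a · r) k            ∎

    ·-assoc : ∀ a b p → (a * b) · p ≈ₚ a · (b · p)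
    ·-assoc a b p .at k = begin
      coeff ((a * b) · p) k ≈⟨ coeff-· (a * b) p k ⟩
      a * b * coeff p k     ≈⟨ *-assoc _ _ _ ⟩
      a * (b * coeff p k)   ≈⟨ *-congˡ (coeff-· b p k) ⟨
      a * coeff (b · p) k   ≈⟨ coeff-· a (b · p) k ⟨
      coeff (a · (b · p)) k ∎

    0·≈[] : ∀ p → 0# · p ≈ₚ []
    0·≈[] p .at k = trans (coeff-· 0# p k) (zeroˡ _)

    1·≈ : ∀ p → 1# · p ≈ₚ p
    1·≈ p .at k = trans (coeff-· 1# p k) (*-identityˡ _)

    ∷-cong : ∀ {a b p r} → a ≈ b → p ≈ₚ r → a ∷ p ≈ₚ b ∷ r
    ∷-cong e f .at zero    = e
    ∷-cong e f .at (suc k) = f .at k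

    0∷[]≈[] : 0# ∷ [] ≈ₚ []
    0∷[]≈[] .at zero    = refl
    0∷[]≈[] .at (suc k) = refl

    +ₚ-interchange : ∀ p r s u → (p +ₚ r) +ₚ (s +ₚ u) ≈ₚ (p +ₚ s) +ₚ (r +ₚ u)
    +ₚ-interchange p r s u .at k = begin
      coeff ((p +ₚ r) +ₚ (s +ₚ u)) k                        ≈⟨ coeff-+ (p +ₚ r) (s +ₚ u) k ⟩
      coeff (p +ₚ r) k + coeff (s +ₚ u) k                   ≈⟨ +-cong (coeff-+ p r k) (coeff-+ s u k) ⟩
      (coeff p k + coeff r k) + (coeff s k + coeff u k)     ≈⟨ interchange _ _ _ _ ⟩
      (coeff p k + coeff s k) + (coeff r k + coeff u k)     ≈⟨ +-cong (coeff-+ p s k) (coeff-+ r u k) ⟨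
      coeff (p +ₚ s) k + coeff (r +ₚ u) k                   ≈⟨ coeff-+ (p +ₚ s) (r +ₚ u) k ⟨
      coeff ((p +ₚ s) +ₚ (r +ₚ u)) k                        ∎

    x+yz≈y+xz : ∀ p r s → p +ₚ (r +ₚ s) ≈ₚ r +ₚ (p +ₚ s)
    x+yz≈y+xz p r s = ≈ₚ-trans (≈ₚ-sym (+ₚ-assoc p r s))
      (≈ₚ-trans (+ₚ-cong (+ₚ-comm p r) ≈ₚ-refl) (+ₚ-assoc r p s))

    *ₚ-congˡ : ∀ p {r r′} → r ≈ₚ r′ → p *ₚ r ≈ₚ p *ₚ r′
    *ₚ-congˡ []      e = ≈ₚ-refl
    *ₚ-congˡ (a ∷ p) e =
      +ₚ-cong (·-cong refl e)
              (∷-cong refl (*ₚ-congˡ p e))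

    *ₚ-zeroʳ : ∀ p → p *ₚ [] ≈ₚ []
    *ₚ-zeroʳ []      = ≈ₚ-refl
    *ₚ-zeroʳ (a ∷ p) = ≈ₚ-trans (∷-cong refl (*ₚ-zeroʳ p)) 0∷[]≈[]

    *ₚ-∷ : ∀ p b r → p *ₚ (b ∷ r) ≈ₚ b · p +ₚ (0# ∷ p *ₚ r)
    *ₚ-∷ []      b r = ≈ₚ-sym 0∷[]≈[]
    *ₚ-∷ (a ∷ p) b r = ∷-cong (+-congʳ (*-comm a b))
      (≈ₚ-trans (+ₚ-cong ≈ₚ-refl (*ₚ-∷ p b r)) (x+yz≈y+xz (a · r) (b · p) (0# ∷ p *ₚ r)))

    *ₚ-comm : ∀ p r → p *ₚ r ≈ₚ r *ₚ p
    *ₚ-comm []      r = ≈ₚ-sym (*ₚ-zeroʳ r)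
    *ₚ-comm (a ∷ p) r =
      ≈ₚ-trans (+ₚ-cong ≈ₚ-refl (∷-cong refl (*ₚ-comm p r)))
               (≈ₚ-sym (*ₚ-∷ r a p))

    *ₚ-cong : ∀ {p p′ r r′} → p ≈ₚ p′ → r ≈ₚ r′ → p *ₚ r ≈ₚ p′ *ₚ r′
    *ₚ-cong {p} {p′} {r} {r′} e f =
      ≈ₚ-trans (*ₚ-congˡ p f) (≈ₚ-trans (*ₚ-comm p r′)
        (≈ₚ-trans (*ₚ-congˡ r′ e) (*ₚ-comm r′ p′)))

    0∷-+ : ∀ p r → 0# ∷ (p +ₚ r) ≈ₚ (0# ∷ p) +ₚ (0# ∷ r)
    0∷-+ p r = ∷-cong (sym (+-identityˡ 0#)) ≈ₚ-refl

    *ₚ-distribˡ : ∀ p r s → p *ₚ (r +ₚ s) ≈ₚ p *ₚ r +ₚ p *ₚ s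
    *ₚ-distribˡ []      r s = ≈ₚ-refl
    *ₚ-distribˡ (a ∷ p) r s =
      ≈ₚ-trans
        (+ₚ-cong (·-distrib a r s)
          (≈ₚ-trans (∷-cong refl (*ₚ-distribˡ p r s)) (0∷-+ (p *ₚ r) (p *ₚ s))))
        (+ₚ-interchange (a · r) (a · s) (0# ∷ p *ₚ r) (0# ∷ p *ₚ s))

    *ₚ-distribʳ : ∀ p r s → (r +ₚ s) *ₚ p ≈ₚ r *ₚ p +ₚ s *ₚ p
    *ₚ-distribʳ p r s =
      ≈ₚ-trans (*ₚ-comm (r +ₚ s) p)
        (≈ₚ-trans (*ₚ-distribˡ p r s) (+ₚ-cong (*ₚ-comm p r) (*ₚ-comm p s)))

    ·-*ₚ : ∀ a p r → (a · p) *ₚ r ≈ₚ a · (p *ₚ r)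
    ·-*ₚ a []      r = ≈ₚ-refl
    ·-*ₚ a (b ∷ p) r = ≈ₚ-trans
      (+ₚ-cong (·-assoc a b r) (∷-cong (sym (zeroʳ a)) (·-*ₚ a p r)))
      (≈ₚ-sym (·-distrib a (b · r) (0# ∷ p *ₚ r)))

    0∷-*ₚ : ∀ p r → (0# ∷ p) *ₚ r ≈ₚ 0# ∷ (p *ₚ r)
    0∷-*ₚ p r = +ₚ-cong {r = 0# ∷ p *ₚ r} (0·≈[] r) ≈ₚ-refl

    *ₚ-assoc : ∀ p r s → (p *ₚ r) *ₚ s ≈ₚ p *ₚ (r *ₚ s)
    *ₚ-assoc []      r s = ≈ₚ-refl
    *ₚ-assoc (a ∷ p) r s =
      ≈ₚ-trans (*ₚ-distribʳ s (a · r) (0# ∷ p *ₚ r))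
        (+ₚ-cong (·-*ₚ a r s)
          (≈ₚ-trans (0∷-*ₚ (p *ₚ r) s) (∷-cong refl (*ₚ-assoc p r s))))

    *ₚ-identityˡ : ∀ p → const 1# *ₚ p ≈ₚ p
    *ₚ-identityˡ p =
      ≈ₚ-trans (+ₚ-cong (1·≈ p) 0∷[]≈[]) (+ₚ-identityʳ p)

  polynomialRing : CommutativeRing c ℓ
  polynomialRing = record
    { Carrier = Poly
    ; _≈_ = _≈ₚ_
    ; _+_ = _+ₚ_
    ; _*_ = _*ₚ_
    ; -_  = -ₚ_
    ; 0#  = []
    ; 1#  = const 1#
    ; isCommutativeRing = record
      { isRing = record
        { +-isAbelianGroup = record
          { isGroup = record
            { isMonoid = record
              { isSemigroup = record
                { isMagma = record
                  { isEquivalence = record { refl = ≈ₚ-refl ; sym = ≈ₚ-sym ; trans = ≈ₚ-trans }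
                  ; ∙-cong = +ₚ-cong
                  }
                ; assoc = +ₚ-assoc
                }
              ; identity = (λ p → ≈ₚ-refl) , +ₚ-identityʳ
              }
            ; inverse = -ₚ-inverseˡ , (λ p → ≈ₚ-trans (+ₚ-comm p (-ₚ p)) (-ₚ-inverseˡ p))
            ; ⁻¹-cong = -ₚ-cong
            }
          ; comm = +ₚ-comm
          }
        ; *-cong = *ₚ-cong
        ; *-assoc = *ₚ-assoc
        ; *-identity = *ₚ-identityˡ , (λ p → ≈ₚ-trans (*ₚ-comm p (const 1#)) (*ₚ-identityˡ p))
        ; distrib = *ₚ-distribˡ , *ₚ-distribʳ
        }
      ; *-comm = *ₚ-comm
      }
    }

-- ℤ[q][x₁]⋯[x_M]: the last variable x_M is the outermost one.
ℤ[q,x]-ring : ℕ → CommutativeRing 0ℓ 0ℓ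
ℤ[q,x]-ring zero    = Polynomial.polynomialRing ℤ-commutativeRing
ℤ[q,x]-ring (suc M) = Polynomial.polynomialRing (ℤ[q,x]-ring M)

ℤ[q,x]-Carrier : ℕ → Set
ℤ[q,x]-Carrier M = CommutativeRing.Carrier (ℤ[q,x]-ring M)

-- The inclusion ℤ[q][x₁,…,x_M] ⊆ ℤ[q][x₁,…,x_{M+1}].
ι : ∀ M → ℤ[q,x]-Carrier M → ℤ[q,x]-Carrier (suc M)
ι M = Polynomial.const (ℤ[q,x]-ring M)

q-var : ∀ M → ℤ[q,x]-Carrier M
q-var zero    = Polynomial.t ℤ-commutativeRing
q-var (suc M) = ι M (q-var M)

-- x-var M c is x_{c+1}.
x-var : ∀ M → Fin M → ℤ[q,x]-Carrier M
x-var (suc M) c with view c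
... | ‵fromℕ     = Polynomial.t (ℤ[q,x]-ring M)
... | ‵inject₁ d = ι M (x-var M d)

module ℤ[q,x] (M : ℕ) where
  open CommutativeRing (ℤ[q,x]-ring M) public
  open Exp semiring public using (_^_)
  open Sum +-commutativeMonoid public using (sum; sum-syntax)
  open Sum *-commutativeMonoid public using () renaming (sum to product)

  q : Carrier
  q = q-var M

  x : Fin M → Carrier
  x = x-var M

-- A partition inside a board with n rows and m columns.  Rows and columns are
-- numbered from 0, so (i , j) is a cell when j < part i.
record Partition (n m : ℕ) : Set where
  field
    part       : Vector ℕ n
    decreasing : ∀ {i k} → i Fin.≤ k → part k ≤ part i
    bounded    : ∀ i → part i ≤ m
open Partition public

-- conjugate μ j is the number of cells in column j, numbered from 0.
conjugate : ∀ {n m} → Partition n m → ℕ → ℕ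
conjugate {n} μ j = length (filter (λ i → j <? part μ i) (allFin n))

private
  punchIn-mono-≤ : ∀ {n} (i : Fin (suc n)) {k l : Fin n} → k Fin.≤ l → punchIn i k Fin.≤ punchIn i l
  punchIn-mono-≤ zero    k≤l = ℕ.s≤s k≤l
  punchIn-mono-≤ (suc i) {zero}  {l}     k≤l         = ℕ.z≤n
  punchIn-mono-≤ (suc i) {suc k} {suc l} (ℕ.s≤s k≤l) = ℕ.s≤s (punchIn-mono-≤ i k≤l)

removeRow : ∀ {n m} → Partition n m → Fin n → Partition (pred n) m
removeRow {suc n} μ i = record
  { part       = removeAt (part μ) i
  ; decreasing = λ k≤l → decreasing μ (punchIn-mono-≤ i k≤l)
  ; bounded    = λ k → bounded μ (punchIn i k)
  }

-- The effect on a row of length a of deleting column j.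
shorten : ℕ → ℕ → ℕ
shorten j a with j <? a
... | yes _ = pred a
... | no  _ = a

private
  shorten-mono : ∀ j {a b} → a ≤ b → shorten j a ≤ shorten j b
  shorten-mono j {a} {b} a≤b with j <? a | j <? b
  ... | yes _   | yes _   = ℕ.pred-mono-≤ a≤b
  ... | yes j<a | no  j≮b with () ← j≮b (ℕ.<-≤-trans j<a a≤b)
  ... | no  j≮a | yes j<b = ℕ.≤-trans (ℕ.≮⇒≥ j≮a) (ℕ.<⇒≤pred j<b)
  ... | no  _   | no  _   = a≤b

  shorten-bounded : ∀ {j a m} → j < m → a ≤ m → shorten j a ≤ pred m
  shorten-bounded {j} {a} j<m a≤m with j <? a
  ... | yes _   = ℕ.pred-mono-≤ a≤m
  ... | no  j≮a = ℕ.≤-trans (ℕ.≮⇒≥ j≮a) (ℕ.<⇒≤pred j<m)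

removeColumn : ∀ {n m} → Partition n m → Fin m → Partition n (pred m)
removeColumn μ j = record
  { part       = λ i → shorten (toℕ j) (part μ i)
  ; decreasing = λ i≤k → shorten-mono (toℕ j) (decreasing μ i≤k)
  ; bounded    = λ i → shorten-bounded (toℕ<n j) (bounded μ i)
  }

-- μ / i: the first m values of i remove a column, the last n remove a row,
-- starting from the bottom row.
_/_ : ∀ {n m} → Partition n m → Fin (m ℕ.+ n) → ∃₂ Partition
_/_ {n} {m} μ i with splitAt m i
... | inj₁ j = n , pred m , removeColumn μ j
... | inj₂ k = pred n , m , removeRow μ (opposite k)

_/cell[_,_] : ∀ {n m} (μ : Partition n m) (i : Fin n) → Fin (part μ i) → Partition (pred n) (pred m)
μ /cell[ i , j ] = removeColumn (removeRow μ i) (Fin.inject≤ j (bounded μ i))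

-- The graph G(μ).  The element v of Fin N is the vertex v + 1, so a cell (i , a)
-- in the 0-based numbering gives the non-edge {a , N - 1 - i}.
module Graph (N : ℕ) {n m : ℕ} (μ : Partition n m) where

  NonEdge : Fin N → Fin N → Set
  NonEdge a b = ∃ λ (i : Fin n) → toℕ a < part μ i × toℕ b ℕ.+ suc (toℕ i) ≡ N

  -- The edges {a , b} with a < b.
  Edge : Fin N → Fin N → Set
  Edge a b = a Fin.< b × ¬ NonEdge a b

  edge? : ∀ a b → Dec (Edge a b)
  edge? a b = (toℕ a <? toℕ b) ×-dec
    ¬? (any? λ i → (toℕ a <? part μ i) ×-dec (toℕ b ℕ.+ suc (toℕ i) ℕ.≟ N))

  Coloring : ℕ → Set
  Coloring M = Vec (Fin M) N

  Proper : ∀ {M} → Coloring M → Set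
  Proper κ = ∀ a b → Edge a b → lookup κ a ≢ lookup κ b

  proper? : ∀ {M} (κ : Coloring M) → Dec (Proper κ)
  proper? κ = all? λ a → all? λ b → edge? a b →-dec ¬? (lookup κ a ≟ lookup κ b)

  asc : ∀ {M} → Coloring M → ℕ
  asc κ = length (filter
    (λ (a , b) → edge? a b ×-dec (toℕ (lookup κ a) <? toℕ (lookup κ b)))
    (cartesianProduct (allFin N) (allFin N)))

allVecs : ∀ M N → List (Vec (Fin M) N)
allVecs M zero    = Vec.[] ∷ []
allVecs M (suc N) = cartesianProductWith Vec._∷_ (allFin M) (allVecs M N)

-- X_μ^N(M); meaningful for N = m + n.
X : ∀ M N {n m} → Partition n m → ℤ[q,x]-Carrier M
X M N μ = foldr _+_ 0# (map term (filter proper? (allVecs M N)))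
  where
  open ℤ[q,x] M
  open Graph N μ

  term : Coloring M → Carrier
  term κ = q ^ asc κ * product (λ v → x (lookup κ v))

{-# OPTIONS --safe #-}

module Submission where

-- Colour the graph of μ on N = m + n vertices with M + 1 colours and split off one
-- colour class A.  Non-edges join column vertices to row vertices, so A is empty, a
-- single vertex, or a non-edge, that is, a cell of μ; deleting A leaves the graph of
-- μ, μ / i or μ /cell[ i , j ] on the remaining vertices.  If the colour of A is the
-- smallest one, then the ascents that meet A are the edges from A to later vertices,
-- and their numbers are the exponents of q in the formula (addBottom-expand).
--
-- But x_{M+1} belongs to the largest colour, for which the edges from earlier vertices
-- into A are counted instead (Z-top).  So the point is that a new colour may be added
-- below the old ones instead of above them without changing the polynomial
-- (addBottom-Z); this is the symmetry of the chromatic polynomial in its variables.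
-- Let T_x and B_x be the operators, on functions of vertex sets, that add a largest or
-- a smallest colour with variable x.  Then B_x commutes with T_y, because both orders
-- count the same edges (addBottom-addTop); T_x commutes with T_y (addTop-comm); and
-- B_x and T_x agree on the polynomial in no variables, which is 1 on the empty set and
-- 0 elsewhere.  The polynomial in M variables arises from that one by applying
-- T_{x_1}, …, T_{x_M}, so B_x and T_x agree on it by induction on M.
--
-- That T_x and T_y commute reduces to a statement about the set U of vertices of the
-- two colours: the sum over the proper colourings of U with two colours is symmetric in
-- x and y (twoColours-sym).  If U has at least four vertices, then both colour classes
-- have exactly two, and each term is symmetric; otherwise there are few possible graphs
-- on U, since the non-edges of G(μ) satisfy the closure conditions of IsAbelian.

open import Algebra.Bundles using (CommutativeMonoid; CommutativeRing)
import Algebra.Properties.CommutativeMonoid.Sum as CommutativeMonoidSum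
import Algebra.Properties.CommutativeSemigroup as CommutativeSemigroupProperties
import Algebra.Properties.Semiring.Exp as SemiringExp
import Algebra.Properties.Semiring.Sum as SemiringSum
import Algebra.Solver.Ring.NaturalCoefficients.Default as SemiringSolver
open import Data.Bool.Base using (Bool; true; false; if_then_else_)
open import Data.Fin.Base using
  (Fin; zero; suc; toℕ; fromℕ; fromℕ<; inject₁; inject≤; opposite; punchIn; punchOut; splitAt)
import Data.Fin.Permutation as Permutation
open import Data.Fin.Properties using
  ( any?; all?; ¬∀⟶∃¬; toℕ-injective; toℕ<n; toℕ-fromℕ; toℕ-fromℕ<; toℕ-inject₁; toℕ-inject≤
  ; toℕ-↑ˡ; toℕ-↑ʳ; splitAt⁻¹-↑ˡ; splitAt⁻¹-↑ʳ; opposite-prop; opposite-involutive; punchIn-punchOut )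
  renaming (_≟_ to _≟ᶠ_)
open import Data.Fin.Relation.Unary.Top using (view-inject₁)
open import Data.List.Base using
  ( List; []; _∷_; _++_; map; foldr; filter; tabulate; allFin; cartesianProduct; cartesianProductWith
  ; length; applyUpTo; upTo )
import Data.List.Properties as List
open import Data.List.Relation.Ternary.Interleaving.Properties using (interleave-length)
open import Data.List.Relation.Ternary.Interleaving.Propositional
  using (Interleaving; consˡ; consʳ; [])
open import Data.List.Relation.Unary.All as All using (All; []; _∷_)
import Data.List.Relation.Unary.All.Properties as All
open import Data.List.Relation.Unary.AllPairs using (AllPairs; []; _∷_)
import Data.List.Relation.Unary.AllPairs.Properties as AllPairs
open import Data.Nat.Base as ℕ using (ℕ; zero; suc; _≤_; _<_; _∸_; z≤n; s≤s)
import Data.Nat.Properties as ℕ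
open import Data.Product.Base using (_×_; _,_; proj₁; proj₂; ∃)
open import Data.Sum.Base using (inj₁; inj₂)
open import Data.Vec.Base as Vec using (Vec; lookup)
open import Function.Base using (_∘_; id)
open import Function.Bundles using (_⇔_; mk⇔; Equivalence)
open import Relation.Binary.PropositionalEquality as ≡ using (_≡_; _≢_)
import Relation.Binary.Reasoning.Setoid as SetoidReasoning
open import Relation.Nullary using (Dec; yes; no; ¬_; does; contradiction)
open import Relation.Nullary.Decidable using
  (dec-true; dec-false; decidable-stable; does-⇔; ¬?; _×-dec_; _→-dec_)
open import Defs

-- Sums over lists

module ListSum {c ℓ} (M : CommutativeMonoid c ℓ) where

  open CommutativeMonoid M
  open CommutativeMonoidSum M using (sum)
  open CommutativeSemigroupProperties commutativeSemigroup using (interchange; x∙yz≈y∙xz)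

  module _ {a} {A : Set a} where

    -- The sum of g over a list; also used multiplicatively, and for counting in ℕ.
    listSum : (A → Carrier) → List A → Carrier
    listSum g []      = ε
    listSum g (a ∷ l) = g a ∙ listSum g l

    listSum-cong : ∀ {g h} l → (∀ a → g a ≈ h a) → listSum g l ≈ listSum h l
    listSum-cong []      e = refl
    listSum-cong (a ∷ l) e = ∙-cong (e a) (listSum-cong l e)

    listSum-∙ : ∀ (g h : A → Carrier) l → listSum (λ a → g a ∙ h a) l ≈ listSum g l ∙ listSum h l
    listSum-∙ g h []      = sym (identityˡ ε)
    listSum-∙ g h (a ∷ l) = trans (∙-congˡ (listSum-∙ g h l)) (interchange _ _ _ _)

    listSum-ε : ∀ {g} {l : List A} → All (λ a → g a ≈ ε) l → listSum g l ≈ ε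
    listSum-ε []       = refl
    listSum-ε (e ∷ es) = trans (∙-cong e (listSum-ε es)) (identityˡ ε)

    listSum-++ : ∀ (g : A → Carrier) k l → listSum g (k ++ l) ≈ listSum g k ∙ listSum g l
    listSum-++ g []      l = sym (identityˡ _)
    listSum-++ g (a ∷ k) l = trans (∙-congˡ (listSum-++ g k l)) (sym (assoc _ _ _))

    listSum-split : ∀ (g : A → Carrier) {k l s} → Interleaving k l s →
      listSum g s ≈ listSum g k ∙ listSum g l
    listSum-split g []         = sym (identityˡ ε)
    listSum-split g (consˡ sp) = trans (∙-congˡ (listSum-split g sp)) (sym (assoc _ _ _))
    listSum-split g (consʳ sp) = trans (∙-congˡ (listSum-split g sp)) (x∙yz≈y∙xz _ _ _)

    listSum-tabulate : ∀ (g : A → Carrier) {n} (f : Fin n → A) →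
      listSum g (tabulate f) ≡ sum (g ∘ f)
    listSum-tabulate g {zero}  f = ≡.refl
    listSum-tabulate g {suc n} f = ≡.cong (g (f zero) ∙_) (listSum-tabulate g (f ∘ suc))

    listSum-applyUpTo : ∀ (g : A → Carrier) f n →
      listSum g (applyUpTo f n) ≡ sum {n} (λ i → g (f (toℕ i)))
    listSum-applyUpTo g f zero    = ≡.refl
    listSum-applyUpTo g f (suc n) = ≡.cong (g (f 0) ∙_) (listSum-applyUpTo g (f ∘ suc) n)

    foldr-filter : ∀ {p} {P : A → Set p} (P? : ∀ a → Dec (P a)) (g : A → Carrier) l →
      foldr _∙_ ε (map g (filter P? l)) ≈ listSum (λ a → if does (P? a) then g a else ε) l
    foldr-filter P? g []      = refl
    foldr-filter P? g (a ∷ l) with does (P? a)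
    ... | true  = ∙-congˡ (foldr-filter P? g l)
    ... | false = trans (foldr-filter P? g l) (sym (identityˡ _))

  module _ {a b} {A : Set a} {B : Set b} where

    listSum-map : ∀ (g : B → Carrier) (f : A → B) l → listSum g (map f l) ≡ listSum (g ∘ f) l
    listSum-map g f []      = ≡.refl
    listSum-map g f (a ∷ l) = ≡.cong (g (f a) ∙_) (listSum-map g f l)

  module _ {a b d} {A : Set a} {B : Set b} {D : Set d} where

    listSum-cartesianProductWith : ∀ (g : D → Carrier) (f : A → B → D) k l →
      listSum g (cartesianProductWith f k l) ≈ listSum (λ a → listSum (λ b → g (f a b)) l) k
    listSum-cartesianProductWith g f []      l = refl
    listSum-cartesianProductWith g f (a ∷ k) l = trans
      (listSum-++ g (map (f a) l) (cartesianProductWith f k l))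
      (∙-cong (reflexive (listSum-map g (f a) l)) (listSum-cartesianProductWith g f k l))

  listSum-allFin : ∀ n (g : Fin n → Carrier) → listSum g (allFin n) ≡ sum g
  listSum-allFin n g = listSum-tabulate g id

  listSum-square : ∀ n (g : Fin n × Fin n → Carrier) →
    listSum g (cartesianProduct (allFin n) (allFin n)) ≈ sum (λ a → sum (λ b → g (a , b)))
  listSum-square n g = trans (listSum-cartesianProductWith g _,_ (allFin n) (allFin n)) (trans
    (listSum-cong (allFin n) (λ a → reflexive (listSum-allFin n (λ b → g (a , b)))))
    (reflexive (listSum-allFin n (λ a → sum (λ b → g (a , b))))))

-- The truth value as a number.
bit : Bool → ℕ
bit e = if e then 1 else 0

length-filter : ∀ {a p} {A : Set a} {P : A → Set p} (P? : ∀ a → Dec (P a)) l →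
  length (filter P? l) ≡ ListSum.listSum ℕ.+-0-commutativeMonoid (λ a → bit (does (P? a))) l
length-filter P? []      = ≡.refl
length-filter P? (a ∷ l) with does (P? a)
... | true  = ≡.cong suc (length-filter P? l)
... | false = length-filter P? l

-- Splittings of a list into two complementary subsequences

module _ {V : Set} where

  All-split : ∀ {P : V → Set} {A B S} → Interleaving A B S → All P S → All P A × All P B
  All-split []         []       = [] , []
  All-split (consˡ sp) (p ∷ ps) = let l , r = All-split sp ps in p ∷ l , r
  All-split (consʳ sp) (p ∷ ps) = let l , r = All-split sp ps in l , p ∷ r

  AllPairs-split : ∀ {_≺_ : V → V → Set} {A B S} →
    Interleaving A B S → AllPairs _≺_ S → AllPairs _≺_ A × AllPairs _≺_ B
  AllPairs-split []         []       = [] , []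
  AllPairs-split (consˡ sp) (p ∷ ps) =
    let l , r = AllPairs-split sp ps in proj₁ (All-split sp p) ∷ l , r
  AllPairs-split (consʳ sp) (p ∷ ps) =
    let l , r = AllPairs-split sp ps in l , proj₂ (All-split sp p) ∷ r

-- punch v enumerates the natural numbers other than v in increasing order, so that
-- applyUpTo (f ∘ punch v) (N ∸ 1) is applyUpTo f N without its entry of index v < N.
punch : ℕ → ℕ → ℕ
punch zero    k       = suc k
punch (suc v) zero    = zero
punch (suc v) (suc k) = suc (punch v k)

module Splits {c ℓ} (R : CommutativeRing c ℓ) where

  open CommutativeRing R hiding (zero)
  open SemiringSum semiring
  open SemiringSolver commutativeSemiring using (solve; _:+_; _:=_)
  open SetoidReasoning setoid

  module _ {V : Set} where

    -- The sum of g A B over the 2 ^ length S ways of splitting the list S into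
    -- two complementary subsequences A and B.
    splitSum : List V → (List V → List V → Carrier) → Carrier
    splitSum []      g = g [] []
    splitSum (v ∷ S) g = splitSum S (λ A B → g (v ∷ A) B) + splitSum S (λ A B → g A (v ∷ B))

    splitSum-cong : ∀ S {g h : List V → List V → Carrier} →
      (∀ {A B} → Interleaving A B S → g A B ≈ h A B) → splitSum S g ≈ splitSum S h
    splitSum-cong []      g≈h = g≈h []
    splitSum-cong (v ∷ S) g≈h =
      +-cong (splitSum-cong S (λ sp → g≈h (consˡ sp))) (splitSum-cong S (λ sp → g≈h (consʳ sp)))

    splitSum-zero : ∀ S {g : List V → List V → Carrier} →
      (∀ {A B} → Interleaving A B S → g A B ≈ 0#) → splitSum S g ≈ 0#
    splitSum-zero []      g≈0 = g≈0 []
    splitSum-zero (v ∷ S) g≈0 = trans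
      (+-cong (splitSum-zero S (λ sp → g≈0 (consˡ sp))) (splitSum-zero S (λ sp → g≈0 (consʳ sp))))
      (+-identityˡ 0#)

    splitSum-+ : ∀ S (g h : List V → List V → Carrier) →
      splitSum S (λ A B → g A B + h A B) ≈ splitSum S g + splitSum S h
    splitSum-+ []      g h = refl
    splitSum-+ (v ∷ S) g h = trans
      (+-cong (splitSum-+ S _ _) (splitSum-+ S _ _))
      (solve 4 (λ a b c d → (a :+ b) :+ (c :+ d) := (a :+ c) :+ (b :+ d)) refl _ _ _ _)

    *-distribˡ-splitSum : ∀ a S (g : List V → List V → Carrier) →
      a * splitSum S g ≈ splitSum S (λ A B → a * g A B)
    *-distribˡ-splitSum a []      g = refl
    *-distribˡ-splitSum a (v ∷ S) g = trans (distribˡ a _ _)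
      (+-cong (*-distribˡ-splitSum a S _) (*-distribˡ-splitSum a S _))

    splitSum-sum : ∀ S {n} (g : Fin n → List V → List V → Carrier) →
      ∑[ i < n ] splitSum S (g i) ≈ splitSum S (λ A B → ∑[ i < n ] g i A B)
    splitSum-sum []      g = refl
    splitSum-sum (v ∷ S) g = trans
      (∑-distrib-+ (λ i → splitSum S (λ A B → g i (v ∷ A) B)) (λ i → splitSum S (λ A B → g i A (v ∷ B))))
      (+-cong (splitSum-sum S (λ i A B → g i (v ∷ A) B)) (splitSum-sum S (λ i A B → g i A (v ∷ B))))

    splitSum-swap : ∀ S (g : List V → List V → Carrier) →
      splitSum S g ≈ splitSum S (λ A B → g B A)
    splitSum-swap []      g = refl
    splitSum-swap (v ∷ S) g = trans (+-comm _ _) (+-cong (splitSum-swap S _) (splitSum-swap S _))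

    -- Both sides sum over the splittings of S into three subsequences.
    splitSum-assoc : ∀ S (g : List V → List V → List V → Carrier) →
      splitSum S (λ A B → splitSum B (λ A′ C → g A A′ C)) ≈
      splitSum S (λ U C → splitSum U (λ A A′ → g A A′ C))
    splitSum-assoc []      g = refl
    splitSum-assoc (v ∷ S) g = begin
      splitSum S (λ A B → splitSum B (g (v ∷ A)))
        + splitSum S (λ A B → splitSum B (λ A′ → g A (v ∷ A′)) + splitSum B (λ A′ C → g A A′ (v ∷ C)))
        ≈⟨ +-congˡ (splitSum-+ S _ _) ⟩
      splitSum S (λ A B → splitSum B (g (v ∷ A)))
        + (splitSum S (λ A B → splitSum B (λ A′ → g A (v ∷ A′)))
        + splitSum S (λ A B → splitSum B (λ A′ C → g A A′ (v ∷ C))))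
        ≈⟨ +-cong (splitSum-assoc S _) (+-cong (splitSum-assoc S _) (splitSum-assoc S _)) ⟩
      splitSum S (λ U C → splitSum U (λ A A′ → g (v ∷ A) A′ C))
        + (splitSum S (λ U C → splitSum U (λ A A′ → g A (v ∷ A′) C))
        + splitSum S (λ U C → splitSum U (λ A A′ → g A A′ (v ∷ C))))
        ≈⟨ +-assoc _ _ _ ⟨
      splitSum S (λ U C → splitSum U (λ A A′ → g (v ∷ A) A′ C))
        + splitSum S (λ U C → splitSum U (λ A A′ → g A (v ∷ A′) C))
        + splitSum S (λ U C → splitSum U (λ A A′ → g A A′ (v ∷ C)))
        ≈⟨ +-congʳ (splitSum-+ S _ _) ⟨
      splitSum S (λ U C → splitSum U (λ A A′ → g (v ∷ A) A′ C) + splitSum U (λ A A′ → g A (v ∷ A′) C))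
        + splitSum S (λ U C → splitSum U (λ A A′ → g A A′ (v ∷ C))) ∎

    splitSum-exchange : ∀ S (g : List V → List V → List V → Carrier) →
      splitSum S (λ A B → splitSum B (λ A′ C → g A A′ C)) ≈
      splitSum S (λ A′ B → splitSum B (λ A C → g A A′ C))
    splitSum-exchange S g = begin
      splitSum S (λ A B → splitSum B (λ A′ C → g A A′ C)) ≈⟨ splitSum-assoc S g ⟩
      splitSum S (λ U C → splitSum U (λ A A′ → g A A′ C))
        ≈⟨ splitSum-cong S (λ {U} {C} _ → splitSum-swap U (λ A A′ → g A A′ C)) ⟩
      splitSum S (λ U C → splitSum U (λ A′ A → g A A′ C)) ≈⟨ splitSum-assoc S (λ A′ A → g A A′) ⟨
      splitSum S (λ A′ B → splitSum B (λ A C → g A A′ C)) ∎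

    -- A sum over splittings that vanishes unless the first part has at most k elements
    -- is a sum over the subsets of at most k indices, here for k = 0, 1, 2.
    splitSum-≤0 : ∀ S (g : List V → List V → Carrier) →
      (∀ {a A B} → Interleaving (a ∷ A) B S → g (a ∷ A) B ≈ 0#) → splitSum S g ≈ g [] S
    splitSum-≤0 []      g g≈0 = refl
    splitSum-≤0 (v ∷ S) g g≈0 = begin
      splitSum S (λ A B → g (v ∷ A) B) + splitSum S (λ A B → g A (v ∷ B))
        ≈⟨ +-cong (splitSum-zero S (λ sp → g≈0 (consˡ sp))) (splitSum-≤0 S _ (λ sp → g≈0 (consʳ sp))) ⟩
      0# + g [] (v ∷ S) ≈⟨ +-identityˡ _ ⟩
      g [] (v ∷ S)      ∎

    splitSum-≤1 : ∀ N (f : ℕ → V) (g : List V → List V → Carrier) →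
      (∀ {a b A B} → Interleaving (a ∷ b ∷ A) B (applyUpTo f N) → g (a ∷ b ∷ A) B ≈ 0#) →
      splitSum (applyUpTo f N) g ≈
      g [] (applyUpTo f N)
        + ∑[ i < N ] g (f (toℕ i) ∷ []) (applyUpTo (f ∘ punch (toℕ i)) (N ∸ 1))
    splitSum-≤1 zero    f g g≈0 = sym (+-identityʳ _)
    splitSum-≤1 (suc N) f g g≈0 = begin
      splitSum S (λ A B → g (f 0 ∷ A) B) + splitSum S (λ A B → g A (f 0 ∷ B))
        ≈⟨ +-cong (splitSum-≤0 S _ (λ sp → g≈0 (consˡ sp)))
                  (splitSum-≤1 N (f ∘ suc) _ (λ sp → g≈0 (consʳ sp))) ⟩
      g (f 0 ∷ []) S + (g [] (f 0 ∷ S) + sum (rest N))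
        ≈⟨ solve 3 (λ a b c → a :+ (b :+ c) := b :+ (a :+ c)) refl _ _ _ ⟩
      g [] (f 0 ∷ S) + (g (f 0 ∷ []) S + sum (rest N))
        ≈⟨ +-congˡ (+-congˡ (sum-cong-≋ (shift N))) ⟩
      g [] (f 0 ∷ S) + (g (f 0 ∷ []) S
        + ∑[ i < N ] g (f (suc (toℕ i)) ∷ []) (applyUpTo (f ∘ punch (suc (toℕ i))) N)) ∎
      where
      S = applyUpTo (f ∘ suc) N
      rest : ∀ N → Fin N → Carrier
      rest N i = g (f (suc (toℕ i)) ∷ []) (f 0 ∷ applyUpTo (f ∘ suc ∘ punch (toℕ i)) (N ∸ 1))
      shift : ∀ N (i : Fin N) →
        rest N i ≈ g (f (suc (toℕ i)) ∷ []) (applyUpTo (f ∘ punch (suc (toℕ i))) N)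
      shift (suc N) i = refl

    splitSum-≤2 : ∀ N (f : ℕ → V) (g : List V → List V → Carrier) →
      (∀ {a b c A B} → Interleaving (a ∷ b ∷ c ∷ A) B (applyUpTo f N) → g (a ∷ b ∷ c ∷ A) B ≈ 0#) →
      splitSum (applyUpTo f N) g ≈
      g [] (applyUpTo f N)
        + ∑[ i < N ] g (f (toℕ i) ∷ []) (applyUpTo (f ∘ punch (toℕ i)) (N ∸ 1))
        + ∑[ i < N ] (∑[ j < toℕ i ] g (f (toℕ j) ∷ f (toℕ i) ∷ [])
            (applyUpTo (f ∘ punch (toℕ i) ∘ punch (toℕ j)) (N ∸ 2)))
    splitSum-≤2 zero    f g g≈0 = sym (trans (+-identityʳ _) (+-identityʳ _))
    splitSum-≤2 (suc N) f g g≈0 = begin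
      splitSum S (λ A B → g (f 0 ∷ A) B) + splitSum S (λ A B → g A (f 0 ∷ B))
        ≈⟨ +-cong (splitSum-≤1 N (f ∘ suc) _ (λ sp → g≈0 (consˡ sp)))
                  (splitSum-≤2 N (f ∘ suc) _ (λ sp → g≈0 (consʳ sp))) ⟩
      g (f 0 ∷ []) S + sum (pair₀ N) + (g [] (f 0 ∷ S) + sum (rest N) + sum (λ i → sum (pair N i)))
        ≈⟨ solve 5 (λ a b c d e → a :+ b :+ (c :+ d :+ e) := c :+ (a :+ d) :+ (b :+ e)) refl _ _ _ _ _ ⟩
      g [] (f 0 ∷ S) + (g (f 0 ∷ []) S + sum (rest N)) + (sum (pair₀ N) + sum (λ i → sum (pair N i)))
        ≈⟨ +-cong (+-congˡ (+-congˡ (sum-cong-≋ (shift N))))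
                  (sym (∑-distrib-+ (pair₀ N) (λ i → sum (pair N i)))) ⟩
      g [] (f 0 ∷ S) + (g (f 0 ∷ []) S + sum (rest′ N)) + sum (λ i → pair₀ N i + sum (pair N i))
        ≈⟨ +-congˡ (trans (sum-cong-≋ (λ i → +-congˡ (sum-cong-≋ (shift₂ N i)))) (sym (+-identityˡ _))) ⟩
      g [] (f 0 ∷ S) + (g (f 0 ∷ []) S + sum (rest′ N)) + (0# + sum (λ i → pair₀ N i + sum (pair′ N i))) ∎
      where
      S = applyUpTo (f ∘ suc) N
      rest rest′ pair₀ : ∀ N → Fin N → Carrier
      rest N i = g (f (suc (toℕ i)) ∷ []) (f 0 ∷ applyUpTo (f ∘ suc ∘ punch (toℕ i)) (N ∸ 1))
      rest′ N i = g (f (suc (toℕ i)) ∷ []) (applyUpTo (f ∘ punch (suc (toℕ i))) N)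
      pair₀ N i = g (f 0 ∷ f (suc (toℕ i)) ∷ []) (applyUpTo (f ∘ suc ∘ punch (toℕ i)) (N ∸ 1))
      pair pair′ : ∀ N (i : Fin N) → Fin (toℕ i) → Carrier
      pair N i j = g (f (suc (toℕ j)) ∷ f (suc (toℕ i)) ∷ [])
        (f 0 ∷ applyUpTo (f ∘ suc ∘ punch (toℕ i) ∘ punch (toℕ j)) (N ∸ 2))
      pair′ N i j = g (f (suc (toℕ j)) ∷ f (suc (toℕ i)) ∷ [])
        (applyUpTo (f ∘ punch (suc (toℕ i)) ∘ punch (suc (toℕ j))) (N ∸ 1))
      shift : ∀ N i → rest N i ≈ rest′ N i
      shift (suc N) i = refl
      shift₂ : ∀ N i j → pair N i j ≈ pair′ N i j
      shift₂ (suc (suc N)) (suc i) j = refl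

-- Weighted colourings

-- E a b says that {a , b} is an edge with a before b in the order _≺_ of the vertices.
-- The two closure conditions hold for every natural unit interval graph; bipartite says
-- that no vertex is both the larger and the smaller end of a non-edge, so independent
-- sets have at most two vertices.
record IsAbelian {V : Set} (_≺_ : V → V → Set) (E : V → V → Bool) : Set where
  field
    irreflexive : ∀ a → E a a ≡ false
    backward  : ∀ {a b} → a ≺ b → E b a ≡ false
    bipartite : ∀ {a b c} → a ≺ b → b ≺ c → E a b ≡ false → E b c ≡ true
    closedˡ   : ∀ {a b c} → a ≺ b → b ≺ c → E b c ≡ false → E a c ≡ false
    closedʳ   : ∀ {a b c} → a ≺ b → b ≺ c → E a b ≡ false → E a c ≡ false

module Colourings {c ℓ} (R : CommutativeRing c ℓ) (q : CommutativeRing.Carrier R) where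

  open CommutativeRing R hiding (zero)
  open SemiringSum semiring
  open SemiringExp semiring
  open SemiringSolver commutativeSemiring using (Polynomial; solve; _:+_; _:*_; _:=_; con)
  open SetoidReasoning setoid
  open Splits R

  open ListSum *-commutativeMonoid public using () renaming
    ( listSum to prod; listSum-cong to prod-cong; listSum-∙ to prod-*
    ; listSum-ε to prod-one; listSum-split to prod-split )

  -- The factor contributed by two vertices of colours c and d, in the order of the
  -- vertices: 0 if an edge is not properly coloured, q if it is an ascent.  The first
  -- argument says whether there is an edge.
  edgeWeight : Bool → ℕ → ℕ → Carrier
  edgeWeight false c d = 1#
  edgeWeight true  c d = if does (c ℕ.≟ d) then 0# else if does (c ℕ.<? d) then q else 1#

  -- The factor q for each edge that is an ascent.
  qIf : Bool → Carrier
  qIf e = if e then q else 1#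

  -- The factor that forbids edges inside a colour class.
  0If : Bool → Carrier
  0If e = if e then 0# else 1#

  edgeWeight-≡ : ∀ e c → edgeWeight e c c ≈ 0If e
  edgeWeight-≡ false c = refl
  edgeWeight-≡ true  c rewrite dec-true (c ℕ.≟ c) ≡.refl = refl

  edgeWeight-< : ∀ e {c d} → c < d → edgeWeight e c d ≈ qIf e
  edgeWeight-< false         c<d = refl
  edgeWeight-< true  {c} {d} c<d
    rewrite dec-false (c ℕ.≟ d) (ℕ.<⇒≢ c<d) | dec-true (c ℕ.<? d) c<d = refl

  edgeWeight-> : ∀ e {c d} → d < c → edgeWeight e c d ≈ 1#
  edgeWeight-> false         d<c = refl
  edgeWeight-> true  {c} {d} d<c
    rewrite dec-false (c ℕ.≟ d) (λ eq → ℕ.<⇒≢ d<c (≡.sym eq)) | dec-false (c ℕ.<? d) (ℕ.<-asym d<c) = refl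

  prod-qIf : ∀ {a} {A : Set a} (e : A → Bool) l →
    prod (λ b → qIf (e b)) l ≈ q ^ ListSum.listSum ℕ.+-0-commutativeMonoid (λ b → bit (e b)) l
  prod-qIf e []      = refl
  prod-qIf e (b ∷ l) with e b
  ... | true  = *-congˡ (prod-qIf e l)
  ... | false = trans (*-identityˡ _) (prod-qIf e l)

  ^-length-filter : ∀ {a p} {A : Set a} {P : A → Set p} (P? : ∀ a → Dec (P a)) l →
    q ^ length (filter P? l) ≈ prod (λ a → qIf (does (P? a))) l
  ^-length-filter P? l = trans (^-congʳ q (length-filter P? l)) (sym (prod-qIf (λ a → does (P? a)) l))

  private
    -- Weights of classes of one, two and three vertices a, b, c, as solver expressions:
    -- nab stands for 0If (E a b), and below eab for qIf (E a b).
    class₁ : ∀ {k} → Polynomial k → Polynomial k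
    class₁ x = x :* (con 1 :* con 1)

    class₂ : ∀ {k} → (x n : Polynomial k) → Polynomial k
    class₂ x n = x :* (n :* con 1 :* class₁ x)

    class₃ : ∀ {k} → (x nab nac nbc : Polynomial k) → Polynomial k
    class₃ x nab nac nbc = x :* (nab :* (nac :* con 1) :* class₂ x nbc)

    -- The eight splittings of a ∷ b ∷ c ∷ [] into classes of variables x and y, the
    -- latter the smaller colour.
    split₃ : ∀ {k} → (x y nab nac nbc eab eac ebc : Polynomial k) → Polynomial k
    split₃ x y nab nac nbc eab eac ebc =
         ((class₃ x nab nac nbc :* con 1 :* con 1
       :+  class₂ x nab :* class₁ y :* (con 1 :* (con 1 :* con 1) :* con 1))
       :+ (class₂ x nac :* class₁ y :* (con 1 :* (ebc :* con 1) :* con 1)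
       :+  class₁ x :* class₂ y nbc :* (con 1 :* con 1 :* (con 1 :* con 1 :* con 1))))
      :+ ((class₂ x nbc :* class₁ y :* (eab :* (eac :* con 1) :* con 1)
       :+  class₁ x :* class₂ y nac :* (eab :* con 1 :* (con 1 :* con 1 :* con 1)))
       :+ (class₁ x :* class₂ y nab :* (eac :* con 1 :* (ebc :* con 1 :* con 1))
       :+  con 1 :* class₃ y nab nac nbc :* (con 1 :* (con 1 :* (con 1 :* con 1)))))

  module OfGraph {V : Set} (E : V → V → Bool) where

    -- The sum, over the proper colourings of the list S of vertices by Fin M, of q ^ asc
    -- times the product of φ v (colour of v) over v ∈ S.  The edges are those from an
    -- entry of S to a later one.  The weight φ depends on the vertex for the sake of the
    -- recursion: once v is coloured, its edges to u are absorbed into the weight of u.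
    Z : ∀ M → (V → Fin M → Carrier) → List V → Carrier
    Z M φ []      = 1#
    Z M φ (v ∷ S) =
      ∑[ c < M ] (φ v c * Z M (λ u d → φ u d * edgeWeight (E v u) (toℕ c) (toℕ d)) S)

    Z-cong : ∀ M {φ χ} S → (∀ v c → φ v c ≈ χ v c) → Z M φ S ≈ Z M χ S
    Z-cong M []      e = refl
    Z-cong M (v ∷ S) e = sum-cong-≋ (λ c → *-cong (e v c) (Z-cong M S (λ u d → *-congʳ (e u d))))

    -- q to the number of edges from A to B.
    qEdges : List V → List V → Carrier
    qEdges A B = prod (λ a → prod (λ b → qIf (E a b)) B) A

    qEdges-splitˡ : ∀ {A B S} C → Interleaving A B S → qEdges S C ≈ qEdges A C * qEdges B C
    qEdges-splitˡ C = prod-split _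

    qEdges-splitʳ : ∀ {A B S} C → Interleaving A B S → qEdges C S ≈ qEdges C A * qEdges C B
    qEdges-splitʳ C sp = trans (prod-cong C (λ a → prod-split _ sp)) (prod-* _ _ C)

    -- The product of φ over A if A is independent, and 0 otherwise.
    classWeight : (V → Carrier) → List V → Carrier
    classWeight φ []      = 1#
    classWeight φ (a ∷ A) = φ a * (prod (λ b → 0If (E a b)) A * classWeight φ A)

    classWeight-* : ∀ (φ ψ : V → Carrier) A →
      classWeight (λ a → φ a * ψ a) A ≈ classWeight φ A * prod ψ A
    classWeight-* φ ψ []      = sym (*-identityˡ 1#)
    classWeight-* φ ψ (a ∷ A) = trans (*-congˡ (*-congˡ (classWeight-* φ ψ A)))
      (solve 5 (λ a b c d e → a :* b :* (c :* (d :* e)) := (a :* (c :* d)) :* (b :* e)) refl _ _ _ _ _)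

    classWeight-cong : ∀ {φ ψ} A → (∀ a → φ a ≈ ψ a) → classWeight φ A ≈ classWeight ψ A
    classWeight-cong []      e = refl
    classWeight-cong (a ∷ A) e = *-cong (e a) (*-congˡ (classWeight-cong A e))

    -- Adding to a function f of vertex sets a new largest (addTop) or smallest
    -- (addBottom) colour with variable x: A is the class of the new colour, and an edge
    -- between A and B is an ascent if it ends, respectively starts, in A.
    addTop addBottom : Carrier → (List V → Carrier) → List V → Carrier
    addTop    x f S = splitSum S (λ A B → classWeight (λ _ → x) A * (qEdges B A * f B))
    addBottom x f S = splitSum S (λ A B → classWeight (λ _ → x) A * (qEdges A B * f B))

    -- U is the set of vertices of the two new colours, and C consists of the others.
    addTop-addTop : ∀ x y f S → addTop x (addTop y f) S ≈
      splitSum S (λ U C → qEdges C U * f C *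
        splitSum U (λ A A′ → classWeight (λ _ → x) A * classWeight (λ _ → y) A′ * qEdges A′ A))
    addTop-addTop x y f S = begin
      splitSum S (λ A B → cx A * (qEdges B A * splitSum B (λ A′ C → cy A′ * (qEdges C A′ * f C))))
        ≈⟨ splitSum-cong S (λ {A} {B} _ → trans (sym (*-assoc _ _ _)) (trans
             (*-distribˡ-splitSum (cx A * qEdges B A) B (λ A′ C → cy A′ * (qEdges C A′ * f C)))
             (splitSum-cong B (λ sp → trans (*-congʳ (*-congˡ (qEdges-splitˡ A sp)))
               (solve 6 (λ a b c d e g → a :* (b :* c) :* (d :* (e :* g)) :=
                                         (a :* d :* b) :* (c :* e :* g)) refl _ _ _ _ _ _))))) ⟩
      splitSum S (λ A B → splitSum B (λ A′ C →
        (cx A * cy A′ * qEdges A′ A) * (qEdges C A * qEdges C A′ * f C)))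
        ≈⟨ splitSum-assoc S (λ A A′ C → (cx A * cy A′ * qEdges A′ A) * (qEdges C A * qEdges C A′ * f C)) ⟩
      splitSum S (λ U C → splitSum U (λ A A′ →
        (cx A * cy A′ * qEdges A′ A) * (qEdges C A * qEdges C A′ * f C)))
        ≈⟨ splitSum-cong S (λ {U} {C} _ → trans
             (splitSum-cong U (λ sp → trans (*-comm _ _) (*-congʳ (*-congʳ (sym (qEdges-splitʳ C sp))))))
             (sym (*-distribˡ-splitSum (qEdges C U * f C) U (λ A A′ → cx A * cy A′ * qEdges A′ A)))) ⟩
      splitSum S (λ U C → qEdges C U * f C * splitSum U (λ A A′ → cx A * cy A′ * qEdges A′ A)) ∎
      where
      cx cy : List V → Carrier
      cx = classWeight (λ _ → x)
      cy = classWeight (λ _ → y)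

    -- In both orders the edges from A to A′, from A to C and from C to A′ are counted.
    addBottom-addTop : ∀ x y f S → addBottom x (addTop y f) S ≈ addTop y (addBottom x f) S
    addBottom-addTop x y f S = begin
      splitSum S (λ A B → cx A * (qEdges A B * splitSum B (λ A′ C → cy A′ * (qEdges C A′ * f C))))
        ≈⟨ splitSum-cong S (λ {A} {B} _ → trans (sym (*-assoc _ _ _)) (trans
             (*-distribˡ-splitSum (cx A * qEdges A B) B (λ A′ C → cy A′ * (qEdges C A′ * f C)))
             (splitSum-cong B (λ sp → trans (*-congʳ (*-congˡ (qEdges-splitʳ A sp)))
               (solve 6 (λ a b c d e g → a :* (b :* c) :* (d :* (e :* g)) :=
                                         (a :* d :* b) :* (c :* e :* g)) refl _ _ _ _ _ _))))) ⟩
      splitSum S (λ A B → splitSum B (λ A′ C → G A A′ C))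
        ≈⟨ splitSum-exchange S G ⟩
      splitSum S (λ A′ B → splitSum B (λ A C → G A A′ C))
        ≈⟨ splitSum-cong S (λ {A′} {B} _ → trans (sym (*-assoc _ _ _)) (trans
             (*-distribˡ-splitSum (cy A′ * qEdges B A′) B (λ A C → cx A * (qEdges A C * f C)))
             (splitSum-cong B (λ sp → trans (*-congʳ (*-congˡ (qEdges-splitˡ A′ sp)))
               (solve 6 (λ a b c d e g → d :* (b :* e) :* (a :* (c :* g)) :=
                                         (a :* d :* b) :* (c :* e :* g)) refl _ _ _ _ _ _))))) ⟨
      splitSum S (λ A′ B → cy A′ * (qEdges B A′ * splitSum B (λ A C → cx A * (qEdges A C * f C)))) ∎
      where
      cx cy : List V → Carrier
      cx = classWeight (λ _ → x)
      cy = classWeight (λ _ → y)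
      G : List V → List V → List V → Carrier
      G A A′ C = (cx A * cy A′ * qEdges A A′) * (qEdges A C * qEdges C A′ * f C)

    module _ {_≺_ : V → V → Set} (isAbelian : IsAbelian _≺_ E) where

      open IsAbelian isAbelian

      private
        Sorted : List V → Set
        Sorted = AllPairs _≺_

      qEdges-backward : ∀ {v B} → All (v ≺_) B → qEdges B (v ∷ []) ≈ 1#
      qEdges-backward v≺B =
        prod-one (All.map (λ v≺b → trans (*-identityʳ _) (one v≺b)) v≺B)
        where
        one : ∀ {v b} → v ≺ b → qIf (E b v) ≈ 1#
        one v≺b rewrite backward v≺b = refl

      -- Splitting off the class A of the largest colour.
      Z-top : ∀ M (φ : V → Fin (suc M) → Carrier) {S} → Sorted S →
        Z (suc M) φ S ≈ splitSum S (λ A B →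
          classWeight (λ a → φ a (fromℕ M)) A * (qEdges B A * Z M (λ b c → φ b (inject₁ c)) B))
      Z-top M φ []                   = sym (trans (*-identityˡ _) (*-identityˡ _))
      Z-top M φ {v ∷ S} (v≺S ∷ S-sorted) = begin
        sum below                           ≈⟨ sum-init-last below ⟩
        sum (below ∘ inject₁) + below top   ≈⟨ +-comm _ _ ⟩
        below top + sum (below ∘ inject₁)   ≈⟨ +-cong inClass notInClass ⟩
        splitSum S (λ A B → term (v ∷ A) B) + splitSum S (λ A B → term A (v ∷ B)) ∎
        where
        top : Fin (suc M)
        top = fromℕ M

        φ′ : Fin (suc M) → V → Fin (suc M) → Carrier
        φ′ c u d = φ u d * edgeWeight (E v u) (toℕ c) (toℕ d)

        below : Fin (suc M) → Carrier
        below c = φ v c * Z (suc M) (φ′ c) S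

        term : List V → List V → Carrier
        term A B = classWeight (λ a → φ a top) A * (qEdges B A * Z M (λ b c → φ b (inject₁ c)) B)

        inject₁<top : ∀ (c : Fin M) → toℕ (inject₁ c) < toℕ top
        inject₁<top c rewrite toℕ-inject₁ c | toℕ-fromℕ M = toℕ<n c

        inClass : below top ≈ splitSum S (λ A B → term (v ∷ A) B)
        inClass = begin
          φ v top * Z (suc M) (φ′ top) S
            ≈⟨ *-congˡ (Z-top M (φ′ top) S-sorted) ⟩
          φ v top * splitSum S (λ A B →
            classWeight (λ a → φ′ top a top) A * (qEdges B A * Z M (λ b c → φ′ top b (inject₁ c)) B))
            ≈⟨ *-distribˡ-splitSum _ S _ ⟩
          splitSum S (λ A B → φ v top * (classWeight (λ a → φ′ top a top) A *
            (qEdges B A * Z M (λ b c → φ′ top b (inject₁ c)) B)))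
            ≈⟨ splitSum-cong S (λ {A} {B} sp → begin
              φ v top * (classWeight (λ a → φ′ top a top) A *
                (qEdges B A * Z M (λ b c → φ′ top b (inject₁ c)) B))
                ≈⟨ *-congˡ (*-cong
                    (trans (classWeight-cong A (λ a → *-congˡ (edgeWeight-≡ (E v a) (toℕ top))))
                           (classWeight-* _ _ A))
                    (*-congˡ (Z-cong M B (λ b c →
                      trans (*-congˡ (edgeWeight-> (E v b) (inject₁<top c))) (*-identityʳ _))))) ⟩
              φ v top * (classWeight (λ a → φ a top) A * prod (λ a → 0If (E v a)) A *
                (qEdges B A * Z M (λ b c → φ b (inject₁ c)) B))
                ≈⟨ solve 5 (λ a b c d e → a :* (b :* c :* (d :* e)) :=
                     (a :* (c :* b)) :* (con 1 :* d :* e)) refl _ _ _ _ _ ⟩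
              classWeight (λ a → φ a top) (v ∷ A) *
                (1# * qEdges B A * Z M (λ b c → φ b (inject₁ c)) B)
                ≈⟨ *-congˡ (*-congʳ (trans
                     (qEdges-splitʳ B (consˡ (rightOnly A)))
                     (*-congʳ (qEdges-backward (proj₂ (All-split sp v≺S)))))) ⟨
              term (v ∷ A) B ∎) ⟩
          splitSum S (λ A B → term (v ∷ A) B) ∎
          where
          rightOnly : ∀ A → Interleaving [] A A
          rightOnly []      = []
          rightOnly (a ∷ A) = consʳ (rightOnly A)

        notInClass : sum (below ∘ inject₁) ≈ splitSum S (λ A B → term A (v ∷ B))
        notInClass = begin
          ∑[ c < M ] (φ v (inject₁ c) * Z (suc M) (φ′ (inject₁ c)) S)
            ≈⟨ sum-cong-≋ (λ c → trans (*-congˡ (Z-top M (φ′ (inject₁ c)) S-sorted))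
                                       (*-distribˡ-splitSum _ S _)) ⟩
          ∑[ c < M ] splitSum S (λ A B → φ v (inject₁ c) *
            (classWeight (λ a → φ′ (inject₁ c) a top) A *
              (qEdges B A * Z M (λ b d → φ′ (inject₁ c) b (inject₁ d)) B)))
            ≈⟨ splitSum-sum S (λ c A B → φ v (inject₁ c) *
                (classWeight (λ a → φ′ (inject₁ c) a top) A *
                  (qEdges B A * Z M (λ b d → φ′ (inject₁ c) b (inject₁ d)) B))) ⟩
          splitSum S (λ A B → ∑[ c < M ] (φ v (inject₁ c) *
            (classWeight (λ a → φ′ (inject₁ c) a top) A *
              (qEdges B A * Z M (λ b d → φ′ (inject₁ c) b (inject₁ d)) B))))
            ≈⟨ splitSum-cong S (λ {A} {B} _ → trans
                 (sum-cong-≋ (λ c → step A B c))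
                 (sym (trans (*-congˡ (*-distribˡ-sum (qEdges (v ∷ B) A) (λ c → lower c B)))
                             (*-distribˡ-sum _ (λ c → qEdges (v ∷ B) A * lower c B))))) ⟩
          splitSum S (λ A B → term A (v ∷ B)) ∎
          where
          lower : Fin M → List V → Carrier
          lower c B = φ v (inject₁ c) *
            Z M (λ b d → φ b (inject₁ d) * edgeWeight (E v b) (toℕ c) (toℕ d)) B

          step : ∀ A B c → φ v (inject₁ c) * (classWeight (λ a → φ′ (inject₁ c) a top) A *
                     (qEdges B A * Z M (λ b d → φ′ (inject₁ c) b (inject₁ d)) B))
            ≈ classWeight (λ a → φ a top) A * (qEdges (v ∷ B) A * lower c B)
          step A B c = begin
            φ v (inject₁ c) * (classWeight (λ a → φ′ (inject₁ c) a top) A *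
              (qEdges B A * Z M (λ b d → φ′ (inject₁ c) b (inject₁ d)) B))
              ≈⟨ *-congˡ (*-cong
                   (trans (classWeight-cong A (λ a → *-congˡ (edgeWeight-< (E v a) (inject₁<top c))))
                          (classWeight-* _ _ A))
                   (*-congˡ (Z-cong M B (λ b d → *-congˡ (reflexive
                     (≡.cong₂ (edgeWeight (E v b)) (toℕ-inject₁ c) (toℕ-inject₁ d))))))) ⟩
            φ v (inject₁ c) * (classWeight (λ a → φ a top) A * prod (λ a → qIf (E v a)) A *
              (qEdges B A * Z M (λ b d → φ b (inject₁ d) * edgeWeight (E v b) (toℕ c) (toℕ d)) B))
              ≈⟨ solve 5 (λ a b c d e → a :* (b :* c :* (d :* e)) := b :* (c :* d :* (a :* e)))
                   refl _ _ _ _ _ ⟩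
            classWeight (λ a → φ a top) A * (qEdges (v ∷ B) A * lower c B) ∎

      -- An independent set has at most two vertices.
      classWeight-triple : ∀ φ {a b c A} → Sorted (a ∷ b ∷ c ∷ A) → classWeight φ (a ∷ b ∷ c ∷ A) ≈ 0#
      classWeight-triple φ {a} {b} {c} ((a≺b ∷ _) ∷ (b≺c ∷ _) ∷ _) with E a b in eq
      ... | true  = trans (*-congˡ (trans (*-congʳ (zeroˡ _)) (zeroˡ _))) (zeroʳ _)
      ... | false rewrite bipartite a≺b b≺c eq =
        trans (*-congˡ (*-congˡ (trans (*-congˡ (trans (*-congʳ (zeroˡ _)) (zeroˡ _))) (zeroʳ _))))
              (trans (*-congˡ (zeroʳ _)) (zeroʳ _))

      -- If at least four vertices are split into independent sets A and B, then both have
      -- two vertices, so x and y occur with the same exponent.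
      classWeights-swap : ∀ x y {u₁ u₂ u₃ u₄ U A B} → Sorted (u₁ ∷ u₂ ∷ u₃ ∷ u₄ ∷ U) →
        Interleaving A B (u₁ ∷ u₂ ∷ u₃ ∷ u₄ ∷ U) →
        classWeight (λ _ → x) A * classWeight (λ _ → y) B ≈
        classWeight (λ _ → y) A * classWeight (λ _ → x) B
      classWeights-swap x y {A = A} {B} U-sorted sp
        with AllPairs-split sp U-sorted | interleave-length sp
      classWeights-swap x y {A = _ ∷ _ ∷ _ ∷ _} sU sp | sA , sB | _ = trans
        (trans (*-congʳ (classWeight-triple _ sA)) (zeroˡ _))
        (sym (trans (*-congʳ (classWeight-triple _ sA)) (zeroˡ _)))
      classWeights-swap x y {A = A} {B = _ ∷ _ ∷ _ ∷ _} sU sp | sA , sB | _ = trans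
        (trans (*-congˡ (classWeight-triple _ sB)) (zeroʳ _))
        (sym (trans (*-congˡ (classWeight-triple _ sB)) (zeroʳ _)))
      classWeights-swap x y {A = a ∷ b ∷ []} {B = c ∷ d ∷ []} sU sp | sA , sB | _ =
        solve 4 (λ x y m n → class₂ x m :* class₂ y n := class₂ y m :* class₂ x n) refl x y (0If (E a b)) (0If (E c d))
      classWeights-swap x y {A = []}         {[]}         sU sp | _ | ()
      classWeights-swap x y {A = []}         {_ ∷ []}     sU sp | _ | ()
      classWeights-swap x y {A = []}         {_ ∷ _ ∷ []} sU sp | _ | ()
      classWeights-swap x y {A = _ ∷ []}     {[]}         sU sp | _ | ()
      classWeights-swap x y {A = _ ∷ []}     {_ ∷ []}     sU sp | _ | ()
      classWeights-swap x y {A = _ ∷ []}     {_ ∷ _ ∷ []} sU sp | _ | ()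
      classWeights-swap x y {A = _ ∷ _ ∷ []} {[]}         sU sp | _ | ()
      classWeights-swap x y {A = _ ∷ _ ∷ []} {_ ∷ []}     sU sp | _ | ()

      -- The sum over the proper colourings of U by two colours, the larger one with
      -- variable x and the smaller one with variable y.
      twoColours : Carrier → Carrier → List V → Carrier
      twoColours x y U = splitSum U (λ A B →
        classWeight (λ _ → x) A * classWeight (λ _ → y) B * qEdges B A)

      twoColours-sym : ∀ x y {U} → Sorted U → twoColours x y U ≈ twoColours y x U
      twoColours-sym x y {[]}    _ = refl
      twoColours-sym x y {a ∷ []} _ = solve 2 (λ x y → W x y := W y x) refl x y
        where
        W : ∀ {k} → (x y : Polynomial k) → Polynomial k
        W x y = class₁ x :* con 1 :* con 1 :+ con 1 :* class₁ y :* (con 1 :* con 1)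
      twoColours-sym x y {a ∷ b ∷ []} ((a≺b ∷ []) ∷ _) rewrite backward a≺b =
        solve 4 (λ x y n e → W x y n e := W y x n e) refl x y (0If (E a b)) (qIf (E a b))
        where
        W : ∀ {k} → (x y n e : Polynomial k) → Polynomial k
        W x y n e =
             (class₂ x n :* con 1 :* con 1
           :+ class₁ x :* class₁ y :* (con 1 :* con 1 :* con 1))
          :+ (class₁ x :* class₁ y :* (e :* con 1 :* con 1)
           :+ con 1 :* class₂ y n :* (con 1 :* (con 1 :* con 1)))
      -- The possible sets of non-edges: none, {a , c} alone, {a , c} with {b , c}, and
      -- {a , c} with {a , b}.
      twoColours-sym x y {a ∷ b ∷ c ∷ []} ((a≺b ∷ a≺c ∷ []) ∷ (b≺c ∷ []) ∷ _)
        rewrite backward a≺b | backward a≺c | backward b≺c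
        with E a b in ab | E b c in bc | E a c in ac
      ... | false | false | _     = contradiction (≡.trans (≡.sym bc) (bipartite a≺b b≺c ab)) λ ()
      ... | false | true  | true  = contradiction (≡.trans (≡.sym ac) (closedʳ a≺b b≺c ab)) λ ()
      ... | true  | false | true  = contradiction (≡.trans (≡.sym ac) (closedˡ a≺b b≺c bc)) λ ()
      ... | false | true  | false = solve 3 (λ x y q →
        split₃ x y (con 1) (con 1) (con 0) (con 1) (con 1) q :=
        split₃ y x (con 1) (con 1) (con 0) (con 1) (con 1) q)
        refl x y q
      ... | true  | false | false = solve 3 (λ x y q →
        split₃ x y (con 0) (con 1) (con 1) q (con 1) (con 1) :=
        split₃ y x (con 0) (con 1) (con 1) q (con 1) (con 1))
        refl x y q
      ... | true  | true  | false = solve 3 (λ x y q →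
        split₃ x y (con 0) (con 1) (con 0) q (con 1) q := split₃ y x (con 0) (con 1) (con 0) q (con 1) q)
        refl x y q
      ... | true  | true  | true  = solve 3 (λ x y q →
        split₃ x y (con 0) (con 0) (con 0) q q q := split₃ y x (con 0) (con 0) (con 0) q q q)
        refl x y q
      twoColours-sym x y {_ ∷ _ ∷ _ ∷ _ ∷ U} U-sorted =
        splitSum-cong (_ ∷ _ ∷ _ ∷ _ ∷ U)
          (λ {A} {B} sp → *-congʳ {qEdges B A} (classWeights-swap x y U-sorted sp))

      addTop-comm : ∀ x y f {S} → Sorted S → addTop x (addTop y f) S ≈ addTop y (addTop x f) S
      addTop-comm x y f {S} S-sorted = begin
        addTop x (addTop y f) S ≈⟨ addTop-addTop x y f S ⟩
        splitSum S (λ U C → qEdges C U * f C * twoColours x y U)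
          ≈⟨ splitSum-cong S (λ sp → *-congˡ (twoColours-sym x y (proj₁ (AllPairs-split sp S-sorted)))) ⟩
        splitSum S (λ U C → qEdges C U * f C * twoColours y x U)
          ≈⟨ addTop-addTop y x f S ⟨
        addTop y (addTop x f) S ∎

      addTop-cong : ∀ x {f g S} → Sorted S → (∀ {B} → Sorted B → f B ≈ g B) → addTop x f S ≈ addTop x g S
      addTop-cong x {S = S} S-sorted f≈g = splitSum-cong S (λ sp →
        *-congˡ (*-congˡ (f≈g (proj₂ (AllPairs-split sp S-sorted)))))

      addBottom-cong : ∀ x {f g S} → Sorted S → (∀ {B} → Sorted B → f B ≈ g B) →
        addBottom x f S ≈ addBottom x g S
      addBottom-cong x {S = S} S-sorted f≈g = splitSum-cong S (λ sp →
        *-congˡ (*-congˡ (f≈g (proj₂ (AllPairs-split sp S-sorted)))))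

      -- A new colour may be added below the others instead of above them.
      addBottom-Z : ∀ x M (xs : Fin M → Carrier) {S} → Sorted S →
        addBottom x (Z M (λ _ → xs)) S ≈ addTop x (Z M (λ _ → xs)) S
      addBottom-Z x zero xs {S} S-sorted = splitSum-cong S (λ {A} {B} _ → *-congˡ (noColour A B))
        where
        noColour : ∀ A B → qEdges A B * Z 0 (λ _ → xs) B ≈ qEdges B A * Z 0 (λ _ → xs) B
        noColour A []      = *-congʳ (prod-one (one A))
          where
          one : ∀ A → All (λ _ → 1# ≈ 1#) A
          one []      = []
          one (_ ∷ A) = refl ∷ one A
        noColour A (_ ∷ B) = trans (zeroʳ _) (sym (zeroʳ _))
      addBottom-Z x (suc M) xs {S} S-sorted = begin
        addBottom x (Z (suc M) (λ _ → xs)) S      ≈⟨ addBottom-cong x S-sorted peel ⟩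
        addBottom x (addTop y (Z M (λ _ → ys))) S ≈⟨ addBottom-addTop x y _ S ⟩
        addTop y (addBottom x (Z M (λ _ → ys))) S ≈⟨ addTop-cong y S-sorted (addBottom-Z x M ys) ⟩
        addTop y (addTop x (Z M (λ _ → ys))) S    ≈⟨ addTop-comm y x _ S-sorted ⟩
        addTop x (addTop y (Z M (λ _ → ys))) S    ≈⟨ addTop-cong x S-sorted peel ⟨
        addTop x (Z (suc M) (λ _ → xs)) S         ∎
        where
        y = xs (fromℕ M)
        ys = xs ∘ inject₁
        peel : ∀ {B} → Sorted B → Z (suc M) (λ _ → xs) B ≈ addTop y (Z M (λ _ → ys)) B
        peel = Z-top M (λ _ → xs)

      -- A colour class contains no edges.
      classWeight-qEdges : ∀ φ {A} → Sorted A → classWeight φ A * qEdges A A ≈ classWeight φ A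
      classWeight-qEdges φ {[]}     _ = *-identityʳ _
      classWeight-qEdges φ {a ∷ []} _ rewrite irreflexive a =
        trans (*-congˡ (trans (*-identityʳ _) (*-identityʳ _))) (*-identityʳ _)
      classWeight-qEdges φ {a ∷ b ∷ []} ((a≺b ∷ []) ∷ _)
        rewrite irreflexive a | irreflexive b | backward a≺b with E a b
      ... | true  = solve 3 (λ x y e →
        (x :* ((con 0 :* con 1) :* y)) :* e := x :* ((con 0 :* con 1) :* y)) refl _ _ _
      ... | false = solve 1 (λ x →
        x :* ((con 1 :* (con 1 :* con 1)) :* ((con 1 :* (con 1 :* con 1)) :* con 1)) := x) refl _
      classWeight-qEdges φ {a ∷ b ∷ c ∷ A} A-sorted = trans
        (trans (*-congʳ (classWeight-triple φ A-sorted)) (zeroˡ _))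
        (sym (classWeight-triple φ A-sorted))

      -- Hence the edges from A to its complement may be counted as all edges from A.
      addBottom-total : ∀ x f {S} → Sorted S → addBottom x f S ≈
        splitSum S (λ A B → classWeight (λ _ → x) A * (qEdges A S * f B))
      addBottom-total x f {S} S-sorted = splitSum-cong S (λ {A} {B} sp → begin
        classWeight (λ _ → x) A * (qEdges A B * f B)
          ≈⟨ *-congʳ (classWeight-qEdges (λ _ → x) (proj₁ (AllPairs-split sp S-sorted))) ⟨
        classWeight (λ _ → x) A * qEdges A A * (qEdges A B * f B)
          ≈⟨ solve 4 (λ a b c d → a :* b :* (c :* d) := a :* (b :* c :* d)) refl _ _ _ _ ⟩
        classWeight (λ _ → x) A * (qEdges A A * qEdges A B * f B)
          ≈⟨ *-congˡ (*-congʳ (qEdges-splitʳ A sp)) ⟨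
        classWeight (λ _ → x) A * (qEdges A S * f B) ∎)

  Z-relabel : ∀ (E E′ : ℕ → ℕ → Bool) M {φ χ : ℕ → Fin M → Carrier} N (f g : ℕ → ℕ) →
    (∀ a b → E (f a) (f b) ≡ E′ (g a) (g b)) → (∀ a c → φ (f a) c ≈ χ (g a) c) →
    OfGraph.Z E M φ (applyUpTo f N) ≈ OfGraph.Z E′ M χ (applyUpTo g N)
  Z-relabel E E′ M zero    f g e h = refl
  Z-relabel E E′ M (suc N) f g e h = sum-cong-≋ (λ c → *-cong (h 0 c)
    (Z-relabel E E′ M N (f ∘ suc) (g ∘ suc) (λ a b → e (suc a) (suc b))
      (λ a d → *-cong (h (suc a) d)
        (reflexive (≡.cong (λ e → edgeWeight e (toℕ c) (toℕ d)) (e 0 (suc a)))))))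

-- The graph of a partition

-- The non-edges and edges of G(μ) with natural numbers as vertices, of which the graph
-- on N vertices has 0, …, N - 1.  Deleting a vertex then needs no transport along
-- equations between numbers of vertices.
NonEdgeℕ : ∀ (N : ℕ) {n m} → Partition n m → ℕ → ℕ → Set
NonEdgeℕ N {n} μ a b = ∃ λ (i : Fin n) → a < part μ i × b ℕ.+ suc (toℕ i) ≡ N

edgeℕ? : ∀ N {n m} (μ : Partition n m) a b → Dec (a < b × ¬ NonEdgeℕ N μ a b)
edgeℕ? N μ a b = (a ℕ.<? b) ×-dec
  ¬? (any? λ i → (a ℕ.<? part μ i) ×-dec (b ℕ.+ suc (toℕ i) ℕ.≟ N))

edge : ∀ N {n m} → Partition n m → ℕ → ℕ → Bool
edge N μ a b = does (edgeℕ? N μ a b)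

edge-backward : ∀ N {n m} (μ : Partition n m) {a b} → a ≤ b → edge N μ b a ≡ false
edge-backward N μ {a} {b} a≤b = dec-false (edgeℕ? N μ b a) (λ (b<a , _) → ℕ.<⇒≱ b<a a≤b)

module _ {n m : ℕ} (μ : Partition n m) where

  nonEdge? : ∀ N a b → Dec (NonEdgeℕ N μ a b)
  nonEdge? N a b = any? λ i → (a ℕ.<? part μ i) ×-dec (b ℕ.+ suc (toℕ i) ℕ.≟ N)

  edge-false⇒nonEdge : ∀ {N a b} → a < b → edge N μ a b ≡ false → NonEdgeℕ N μ a b
  edge-false⇒nonEdge {N} {a} {b} a<b eq = decidable-stable (nonEdge? N a b) λ ¬ne →
    contradiction (≡.trans (≡.sym eq) (dec-true (edgeℕ? N μ a b) (a<b , ¬ne))) λ ()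

  nonEdge⇒edge-false : ∀ {N a b} → NonEdgeℕ N μ a b → edge N μ a b ≡ false
  nonEdge⇒edge-false {N} {a} {b} ne = dec-false (edgeℕ? N μ a b) (λ (_ , ¬ne) → ¬ne ne)

  -- A non-edge joins one of the m column vertices to one of the n row vertices.
  nonEdge-column : ∀ {N a b} → NonEdgeℕ N μ a b → a < m
  nonEdge-column (i , a<μᵢ , _) = ℕ.<-≤-trans a<μᵢ (bounded μ i)

  nonEdge-row : ∀ {a b} → NonEdgeℕ (m ℕ.+ n) μ a b → m ≤ b
  nonEdge-row {a} {b} (i , _ , eq) = ℕ.+-cancelʳ-≤ n m b
    (ℕ.≤-trans (ℕ.≤-reflexive (≡.sym eq)) (ℕ.+-monoʳ-≤ b (toℕ<n i)))

  rowOf : ∀ {b} → m ≤ b → b < m ℕ.+ n → ∃ λ (i : Fin n) → b ℕ.+ suc (toℕ i) ≡ m ℕ.+ n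
  rowOf {b} m≤b b<N = fromℕ< i<n , ≡.trans (≡.cong (λ i → b ℕ.+ suc i) (toℕ-fromℕ< i<n))
    (≡.trans (ℕ.+-suc b _) (ℕ.m+[n∸m]≡n b<N))
    where
    i<n : m ℕ.+ n ∸ suc b < n
    i<n = ℕ.+-cancelˡ-< b _ _ (ℕ.<-≤-trans (ℕ.≤-reflexive (ℕ.m+[n∸m]≡n b<N)) (ℕ.+-monoˡ-≤ n m≤b))

  edge-isAbelian : IsAbelian (λ a b → a < b × b < m ℕ.+ n) (edge (m ℕ.+ n) μ)
  edge-isAbelian = record
    { irreflexive = λ a → edge-backward (m ℕ.+ n) μ ℕ.≤-refl
    ; backward  = λ (a<b , _) → edge-backward (m ℕ.+ n) μ (ℕ.<⇒≤ a<b)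
    ; bipartite = λ {a} {b} {c} (a<b , _) (b<c , _) eq → dec-true (edgeℕ? (m ℕ.+ n) μ b c)
        (b<c , λ ne → ℕ.<⇒≱ (nonEdge-column ne) (nonEdge-row (edge-false⇒nonEdge a<b eq)))
    ; closedˡ   = λ (a<b , _) (b<c , _) eq → let (i , b<μᵢ , row) = edge-false⇒nonEdge b<c eq in
        nonEdge⇒edge-false (i , ℕ.<-trans a<b b<μᵢ , row)
    ; closedʳ   = λ {a} {b} {c} (a<b , _) (b<c , c<N) eq →
        let ne = edge-false⇒nonEdge a<b eq
            (i , a<μᵢ , row) = ne
            (k , row′) = rowOf (ℕ.≤-trans (nonEdge-row ne) (ℕ.<⇒≤ b<c)) c<N
            k≤i = ℕ.<⇒≤ (ℕ.s<s⁻¹ (ℕ.+-cancelˡ-< b _ _ (ℕ.<-≤-trans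
                    (ℕ.+-monoˡ-< _ b<c) (ℕ.≤-reflexive (≡.trans row′ (≡.sym row))))))
        in nonEdge⇒edge-false (k , ℕ.<-≤-trans a<μᵢ (decreasing μ k≤i) , row′)
    }

-- Deleting vertices from the graph of a partition

punch-< : ∀ {v k} → k < v → punch v k ≡ k
punch-< {suc v} {zero}  _         = ≡.refl
punch-< {suc v} {suc k} (s≤s k<v) = ≡.cong suc (punch-< k<v)

punch-≥ : ∀ {v k} → v ≤ k → punch v k ≡ suc k
punch-≥ {zero}  {k}     _         = ≡.refl
punch-≥ {suc v} {suc k} (s≤s v≤k) = ≡.cong suc (punch-≥ v≤k)

k≤punch : ∀ v k → k ≤ punch v k
k≤punch zero    k       = ℕ.n≤1+n k
k≤punch (suc v) zero    = z≤n
k≤punch (suc v) (suc k) = s≤s (k≤punch v k)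

punch≢ : ∀ v k → punch v k ≢ v
punch≢ zero    k       ()
punch≢ (suc v) zero    ()
punch≢ (suc v) (suc k) eq = punch≢ v k (ℕ.suc-injective eq)

punch-mono-< : ∀ v {a b} → a < b → punch v a < punch v b
punch-mono-< zero                    a<b       = s≤s a<b
punch-mono-< (suc v) {zero}  {suc b} _         = s≤s z≤n
punch-mono-< (suc v) {suc a} {suc b} (s≤s a<b) = s≤s (punch-mono-< v a<b)

punch-cancel-< : ∀ v {a b} → punch v a < punch v b → a < b
punch-cancel-< zero                    (s≤s a<b) = a<b
punch-cancel-< (suc v) {zero}  {suc b} _         = s≤s z≤n
punch-cancel-< (suc v) {suc a} {suc b} (s≤s a<b) = s≤s (punch-cancel-< v a<b)

toℕ-punchIn : ∀ {n} (i : Fin (suc n)) k → toℕ (punchIn i k) ≡ punch (toℕ i) (toℕ k)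
toℕ-punchIn zero    k       = ≡.refl
toℕ-punchIn (suc i) zero    = ≡.refl
toℕ-punchIn (suc i) (suc k) = ≡.cong suc (toℕ-punchIn i k)

-- On N = v + suc r vertices, row r belongs to vertex v, and row k to vertex b if
-- b + suc k = N.  Deleting v and r preserves this correspondence.
punch-row : ∀ v r b k → punch v b ℕ.+ suc (punch r k) ≡ v ℕ.+ suc r ⇔ b ℕ.+ suc k ≡ v ℕ.+ r
punch-row v r b k with b ℕ.<? v | k ℕ.<? r
... | yes b<v | yes k<r rewrite punch-< b<v | punch-< k<r = mk⇔
  (λ eq → contradiction eq (ℕ.<⇒≢ (ℕ.+-mono-<-≤ b<v (ℕ.m≤n⇒m≤1+n k<r))))
  (λ eq → contradiction eq (ℕ.<⇒≢ (ℕ.+-mono-<-≤ b<v k<r)))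
... | yes b<v | no k≮r rewrite punch-< b<v | punch-≥ (ℕ.≮⇒≥ k≮r) | ℕ.+-suc b (suc k) | ℕ.+-suc v r =
  mk⇔ ℕ.suc-injective (≡.cong suc)
... | no b≮v | yes k<r rewrite punch-≥ (ℕ.≮⇒≥ b≮v) | punch-< k<r | ℕ.+-suc v r =
  mk⇔ ℕ.suc-injective (≡.cong suc)
... | no b≮v | no k≮r rewrite punch-≥ (ℕ.≮⇒≥ b≮v) | punch-≥ (ℕ.≮⇒≥ k≮r) = mk⇔
  (λ eq → contradiction (≡.sym eq) (ℕ.<⇒≢ (ℕ.+-mono-<-≤ (s≤s (ℕ.≮⇒≥ b≮v)) (s≤s (ℕ.m≤n⇒m≤1+n (ℕ.≮⇒≥ k≮r))))))
  (λ eq → contradiction (≡.sym eq) (ℕ.<⇒≢ (ℕ.+-mono-≤-< (ℕ.≮⇒≥ b≮v) (s≤s (ℕ.≮⇒≥ k≮r)))))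

-- Deleting column j shortens exactly the rows that reach beyond it.
punch<⇔<shorten : ∀ j a p → punch j a < p ⇔ a < shorten j p
punch<⇔<shorten j a p with j ℕ.<? p | a ℕ.<? j
... | yes j<p | yes a<j rewrite punch-< a<j =
  mk⇔ (λ _ → ℕ.<-≤-trans a<j (ℕ.<⇒≤pred j<p)) (λ _ → ℕ.<-trans a<j j<p)
punch<⇔<shorten j a (suc p) | yes j<p | no a≮j rewrite punch-≥ (ℕ.≮⇒≥ a≮j) = mk⇔ ℕ.s<s⁻¹ s≤s
punch<⇔<shorten j a p | no j≮p | yes a<j rewrite punch-< a<j = mk⇔ id id
punch<⇔<shorten j a p | no j≮p | no a≮j rewrite punch-≥ (ℕ.≮⇒≥ a≮j) =
  mk⇔ ℕ.<⇒≤ (λ a<p → contradiction (ℕ.≤-<-trans (ℕ.≮⇒≥ a≮j) a<p) j≮p)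

edge-⇔ : ∀ {n m n′ m′} (μ : Partition n m) (ν : Partition n′ m′) N N′ v {a b} →
  NonEdgeℕ N μ (punch v a) (punch v b) ⇔ NonEdgeℕ N′ ν a b →
  edge N μ (punch v a) (punch v b) ≡ edge N′ ν a b
edge-⇔ μ ν N N′ v {a} {b} e = does-⇔
  (mk⇔ (λ (a<b , ¬ne) → punch-cancel-< v a<b , ¬ne ∘ Equivalence.from e)
       (λ (a<b , ¬ne) → punch-mono-< v a<b , ¬ne ∘ Equivalence.to e))
  (edgeℕ? N μ (punch v a) (punch v b)) (edgeℕ? N′ ν a b)

edge-removeColumn : ∀ {n m} (μ : Partition n m) (j : Fin m) a b →
  edge (m ℕ.+ n) μ (punch (toℕ j) a) (punch (toℕ j) b) ≡ edge (m ℕ.+ n ∸ 1) (removeColumn μ j) a b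
edge-removeColumn {n} {suc m} μ j a b = edge-⇔ μ (removeColumn μ j) (suc m ℕ.+ n) (m ℕ.+ n) (toℕ j) (mk⇔
  (λ (i , a<μᵢ , row) → i , Equivalence.to (punch<⇔<shorten (toℕ j) a (part μ i)) a<μᵢ ,
    Equivalence.to (rows i) row)
  (λ (i , a<μᵢ , row) → i , Equivalence.from (punch<⇔<shorten (toℕ j) a (part μ i)) a<μᵢ ,
    Equivalence.from (rows i) row))
  where
  rows : ∀ (i : Fin n) → punch (toℕ j) b ℕ.+ suc (toℕ i) ≡ suc m ℕ.+ n ⇔ b ℕ.+ suc (toℕ i) ≡ m ℕ.+ n
  rows i with b ℕ.<? toℕ j
  ... | no b≮j rewrite punch-≥ (ℕ.≮⇒≥ b≮j) = mk⇔ ℕ.suc-injective (≡.cong suc)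
  ... | yes b<j rewrite punch-< b<j = mk⇔
    (λ eq → contradiction eq (ℕ.<⇒≢ (ℕ.m≤n⇒m≤1+n tooSmall)))
    (λ eq → contradiction eq (ℕ.<⇒≢ tooSmall))
    where
    tooSmall : b ℕ.+ suc (toℕ i) < m ℕ.+ n
    tooSmall = ℕ.+-mono-<-≤ (ℕ.<-≤-trans b<j (ℕ.s≤s⁻¹ (toℕ<n j))) (toℕ<n i)

edge-removeRow : ∀ {n m} (μ : Partition n m) (r : Fin n) N v → m ≤ v → v ℕ.+ suc (toℕ r) ≡ N → ∀ a b →
  edge N μ (punch v a) (punch v b) ≡ edge (N ∸ 1) (removeRow μ r) a b
edge-removeRow {suc n} {m} μ r N v m≤v ≡.refl a b
  rewrite ℕ.+-suc v (toℕ r) = edge-⇔ μ (removeRow μ r) (suc (v ℕ.+ toℕ r)) (v ℕ.+ toℕ r) v (mk⇔ to from)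
  where
  to : NonEdgeℕ (suc (v ℕ.+ toℕ r)) μ (punch v a) (punch v b) → NonEdgeℕ (v ℕ.+ toℕ r) (removeRow μ r) a b
  to (i , a<μᵢ , row) = punchOut r≢i ,
    ℕ.≤-<-trans (k≤punch v a) (≡.subst (λ i → punch v a < part μ i) i≡ a<μᵢ) ,
    Equivalence.to (punch-row v (toℕ r) b _)
      (≡.trans (≡.cong (λ k → punch v b ℕ.+ suc k) (≡.trans (≡.sym (toℕ-punchIn r _)) (≡.cong toℕ (≡.sym i≡))))
             (≡.trans row (≡.sym (ℕ.+-suc v (toℕ r)))))
    where
    r≢i : r ≢ i
    r≢i ≡.refl = punch≢ v b (ℕ.+-cancelʳ-≡ (suc (toℕ r)) _ _ (≡.trans row (≡.sym (ℕ.+-suc v (toℕ r)))))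
    i≡ : i ≡ punchIn r (punchOut r≢i)
    i≡ = ≡.sym (punchIn-punchOut r≢i)
  from : NonEdgeℕ (v ℕ.+ toℕ r) (removeRow μ r) a b → NonEdgeℕ (suc (v ℕ.+ toℕ r)) μ (punch v a) (punch v b)
  from (i , a<μᵢ , row) = punchIn r i ,
    ≡.subst (_< part μ (punchIn r i)) (≡.sym (punch-< (ℕ.<-≤-trans a<μᵢ (ℕ.≤-trans (bounded μ _) m≤v)))) a<μᵢ ,
    ≡.trans (≡.cong (λ k → punch v b ℕ.+ suc k) (toℕ-punchIn r i))
      (≡.trans (Equivalence.from (punch-row v (toℕ r) b (toℕ i)) row) (ℕ.+-suc v (toℕ r)))

-- Counting the edges at a vertex

module RangeSum {c ℓ} (M : CommutativeMonoid c ℓ) where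

  open CommutativeMonoid M
  open CommutativeMonoidSum M

  sum-ε : ∀ {n} {f : Fin n → Carrier} → (∀ i → f i ≈ ε) → sum f ≈ ε
  sum-ε {n} e = trans (sum-cong-≋ e) (sum-replicate-zero n)

  sum-+ : ∀ m n (g : ℕ → Carrier) →
    ∑[ k < m ℕ.+ n ] g (toℕ k) ≈ ∑[ k < m ] g (toℕ k) ∙ ∑[ k < n ] g (m ℕ.+ toℕ k)
  sum-+ zero    n g = sym (identityˡ _)
  sum-+ (suc m) n g = trans (∙-congˡ (sum-+ m n (g ∘ suc))) (sym (assoc _ _ _))

  -- The vertex of row i is m + opposite i.
  sum-columns-rows : ∀ m n (g : ℕ → Carrier) →
    ∑[ k < m ℕ.+ n ] g (toℕ k) ≈ ∑[ k < m ] g (toℕ k) ∙ ∑[ i < n ] g (m ℕ.+ toℕ (opposite i))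
  sum-columns-rows m n g = trans (sum-+ m n g)
    (∙-congˡ (sum-permute {n} {n} (λ k → g (m ℕ.+ toℕ k)) Permutation.reverse))

  sum-truncate : ∀ {a b} (g : ℕ → Carrier) → a ≤ b → (∀ {k} → a ≤ k → k < b → g k ≈ ε) →
    ∑[ k < b ] g (toℕ k) ≈ ∑[ k < a ] g (toℕ k)
  sum-truncate g z≤n       g≈ε = sum-ε (λ k → g≈ε z≤n (toℕ<n k))
  sum-truncate g (s≤s a≤b) g≈ε =
    ∙-congˡ (sum-truncate (g ∘ suc) a≤b (λ a≤k k<b → g≈ε (s≤s a≤k) (s≤s k<b)))

m+opposite : ∀ m {n} (i : Fin n) → m ℕ.+ toℕ (opposite i) ℕ.+ suc (toℕ i) ≡ m ℕ.+ n
m+opposite m {n} i = ≡.trans (ℕ.+-assoc m _ _) (≡.cong (m ℕ.+_)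
  (≡.trans (≡.cong (ℕ._+ suc (toℕ i)) (opposite-prop i)) (ℕ.m∸n+n≡m (toℕ<n i))))

module Σᴺ = CommutativeMonoidSum ℕ.+-0-commutativeMonoid
open Σᴺ using () renaming (sum to sumℕ)

bit-difference : ∀ {p r} {P : Set p} {Q : Set r} (p? : Dec P) (q? : Dec Q) → (Q → P) →
  bit (does (p? ×-dec ¬? q?)) ℕ.+ bit (does q?) ≡ bit (does p?)
bit-difference (yes _) (yes _) Q⇒P = ≡.refl
bit-difference (yes _) (no _)  Q⇒P = ≡.refl
bit-difference (no _)  (no _)  Q⇒P = ≡.refl
bit-difference (no ¬p) (yes q) Q⇒P = contradiction (Q⇒P q) ¬p

count-< : ∀ N v → sumℕ {N} (λ b → bit (does (v ℕ.<? toℕ b))) ≡ N ∸ suc v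
count-< zero    v       = ≡.refl
count-< (suc N) zero    = all N
  where
  all : ∀ N → sumℕ {N} (λ b → bit (does (0 ℕ.<? suc (toℕ b)))) ≡ N
  all zero    = ≡.refl
  all (suc N) = ≡.cong suc (all N)
count-< (suc N) (suc v) = ≡.trans (Σᴺ.sum-cong-≗ {N} (λ b → ≡.cong bit
  (does-⇔ (mk⇔ ℕ.s<s⁻¹ s≤s) (suc v ℕ.<? suc (toℕ b)) (v ℕ.<? toℕ b)))) (count-< N v)

nonEdge-opposite : ∀ {n m} (μ : Partition n m) {v} (i : Fin n) →
  NonEdgeℕ (m ℕ.+ n) μ v (m ℕ.+ toℕ (opposite i)) ⇔ v < part μ i
nonEdge-opposite {n} {m} μ {v} i = mk⇔
  (λ (k , v<μₖ , eq) → ≡.subst (λ k → v < part μ k)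
    (toℕ-injective (ℕ.suc-injective (ℕ.+-cancelˡ-≡ _ _ _ (≡.trans eq (≡.sym (m+opposite m i)))))) v<μₖ)
  (λ v<μᵢ → i , v<μᵢ , m+opposite m i)

module _ {n m : ℕ} (μ : Partition n m) where

  -- The non-edges that start at v correspond to the cells in column v.
  nonDegree : ∀ v → sumℕ {m ℕ.+ n} (λ b → bit (does (nonEdge? μ (m ℕ.+ n) v (toℕ b)))) ≡ conjugate μ v
  nonDegree v = begin
    sumℕ {m ℕ.+ n} (λ b → g (toℕ b))
      ≡⟨ sum-columns-rows m n g ⟩
    sumℕ {m} (λ b → g (toℕ b)) ℕ.+ sumℕ {n} (λ i → g (m ℕ.+ toℕ (opposite i)))
      ≡⟨ ≡.cong₂ ℕ._+_
           (sum-ε (λ b → ≡.cong bit (dec-false (nonEdge? μ (m ℕ.+ n) v (toℕ b))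
             (λ ne → ℕ.<⇒≱ (toℕ<n b) (nonEdge-row μ ne)))))
           (Σᴺ.sum-cong-≗ {n} (λ i → ≡.cong bit
             (does-⇔ (nonEdge-opposite μ i) (nonEdge? μ (m ℕ.+ n) v _) (v ℕ.<? part μ i)))) ⟩
    sumℕ {n} (λ i → bit (does (v ℕ.<? part μ i)))
      ≡⟨ ListSum.listSum-allFin ℕ.+-0-commutativeMonoid n _ ⟨
    ListSum.listSum ℕ.+-0-commutativeMonoid (λ i → bit (does (v ℕ.<? part μ i))) (allFin n)
      ≡⟨ length-filter (λ i → v ℕ.<? part μ i) (allFin n) ⟨
    conjugate μ v ∎
    where
    open ≡.≡-Reasoning
    open RangeSum ℕ.+-0-commutativeMonoid
    g : ℕ → ℕ
    g b = bit (does (nonEdge? μ (m ℕ.+ n) v b))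

  -- The number of edges from v to later vertices.
  degree : ∀ v → sumℕ {m ℕ.+ n} (λ b → bit (edge (m ℕ.+ n) μ v (toℕ b))) ≡ m ℕ.+ n ∸ suc v ∸ conjugate μ v
  degree v = begin
    deg                                       ≡⟨ ℕ.m+n∸n≡m deg (conjugate μ v) ⟨
    deg ℕ.+ conjugate μ v ∸ conjugate μ v     ≡⟨ ≡.cong (_∸ conjugate μ v) total ⟩
    m ℕ.+ n ∸ suc v ∸ conjugate μ v           ∎
    where
    open ≡.≡-Reasoning
    deg = sumℕ {m ℕ.+ n} (λ b → bit (edge (m ℕ.+ n) μ v (toℕ b)))
    -- Every vertex after v is joined to v either by an edge or by a non-edge.
    pair : ∀ b → bit (edge (m ℕ.+ n) μ v b) ℕ.+ bit (does (nonEdge? μ (m ℕ.+ n) v b)) ≡ bit (does (v ℕ.<? b))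
    pair b = bit-difference (v ℕ.<? b) (nonEdge? μ (m ℕ.+ n) v b)
      (λ ne → ℕ.<-≤-trans (nonEdge-column μ ne) (nonEdge-row μ ne))
    total : deg ℕ.+ conjugate μ v ≡ m ℕ.+ n ∸ suc v
    total = begin
      deg ℕ.+ conjugate μ v
        ≡⟨ ≡.cong (deg ℕ.+_) (nonDegree v) ⟨
      deg ℕ.+ sumℕ {m ℕ.+ n} (λ b → bit (does (nonEdge? μ (m ℕ.+ n) v (toℕ b))))
        ≡⟨ Σᴺ.∑-distrib-+ {m ℕ.+ n} _ _ ⟨
      sumℕ {m ℕ.+ n} (λ b → bit (edge (m ℕ.+ n) μ v (toℕ b)) ℕ.+ bit (does (nonEdge? μ (m ℕ.+ n) v (toℕ b))))
        ≡⟨ Σᴺ.sum-cong-≗ {m ℕ.+ n} (λ b → pair (toℕ b)) ⟩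
      sumℕ {m ℕ.+ n} (λ b → bit (does (v ℕ.<? toℕ b)))
        ≡⟨ count-< (m ℕ.+ n) v ⟩
      m ℕ.+ n ∸ suc v ∎

-- Chromatic polynomials as weighted sums over colourings

module Chromatic {c ℓ} (R : CommutativeRing c ℓ) (q : CommutativeRing.Carrier R) where

  open CommutativeRing R hiding (zero)
  open SemiringSum semiring
  open SemiringExp semiring
  open SemiringSolver commutativeSemiring using (solve; _:*_; _:=_; con)
  open SetoidReasoning setoid
  open Colourings R q
  module Σᴸ = ListSum +-commutativeMonoid
  module Πᴸ = ListSum *-commutativeMonoid
  module Π = CommutativeMonoidSum *-commutativeMonoid

  product : ∀ {n} → (Fin n → Carrier) → Carrier
  product = Π.sum

  product-zero : ∀ {n} (f : Fin n → Carrier) i → f i ≈ 0# → product f ≈ 0#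
  product-zero f zero    e = trans (*-congʳ e) (zeroˡ _)
  product-zero f (suc i) e = trans (*-congˡ (product-zero (f ∘ suc) i e)) (zeroʳ _)

  product-one : ∀ {n} (f : Fin n → Carrier) → (∀ i → f i ≈ 1#) → product f ≈ 1#
  product-one {zero}  f e = refl
  product-one {suc n} f e = trans (*-cong (e zero) (product-one (f ∘ suc) (e ∘ suc))) (*-identityˡ 1#)

  *-distribˡ-listSum : ∀ {a} {A : Set a} x (g : A → Carrier) l →
    x * Σᴸ.listSum g l ≈ Σᴸ.listSum (λ a → x * g a) l
  *-distribˡ-listSum x g []      = zeroʳ x
  *-distribˡ-listSum x g (a ∷ l) = trans (distribˡ x _ _) (+-congˡ (*-distribˡ-listSum x g l))

  edgeWeight-≢ : ∀ {p} {P : Set p} (e? : Dec P) {c d} → (P → c ≢ d) →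
    edgeWeight (does e?) c d ≈ qIf (does (e? ×-dec (c ℕ.<? d)))
  edgeWeight-≢ (no  _)         c≢d = refl
  edgeWeight-≢ (yes e) {c} {d} c≢d rewrite dec-false (c ℕ.≟ d) (c≢d e) = refl

  edgeWeight-zero : ∀ {p} {P : Set p} (e? : Dec P) {c d} → P → c ≡ d → edgeWeight (does e?) c d ≈ 0#
  edgeWeight-zero e? {c} e ≡.refl rewrite dec-true e? e = edgeWeight-≡ true c

  module _ (E : ℕ → ℕ → Bool) where
    open OfGraph E

    -- The product of the factors of all pairs of vertices f 0, …, f (N - 1).
    edgeProduct : ∀ {M N} → (ℕ → ℕ) → Vec (Fin M) N → Carrier
    edgeProduct f κ = product λ a → product λ b →
      edgeWeight (E (f (toℕ a)) (f (toℕ b))) (toℕ (lookup κ a)) (toℕ (lookup κ b))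

    -- By backward, every edge leads from some f a to f b with a < b.
    listSum-allVecs : ∀ M N f (φ : ℕ → Fin M → Carrier) →
      (∀ {a b} → a ≤ b → E (f b) (f a) ≡ false) →
      Σᴸ.listSum (λ κ → product (λ v → φ (f (toℕ v)) (lookup κ v)) * edgeProduct f κ) (allVecs M N) ≈
      Z M φ (applyUpTo f N)
    listSum-allVecs M zero    f φ backward = trans (+-identityʳ _) (*-identityˡ 1#)
    listSum-allVecs M (suc N) f φ backward = begin
      Σᴸ.listSum (weight f φ) (allVecs M (suc N))
        ≈⟨ Σᴸ.listSum-cartesianProductWith _ Vec._∷_ (allFin M) (allVecs M N) ⟩
      Σᴸ.listSum (λ c → Σᴸ.listSum (λ κ → weight f φ (c Vec.∷ κ)) (allVecs M N)) (allFin M)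
        ≡⟨ Σᴸ.listSum-allFin M (λ c → Σᴸ.listSum (λ κ → weight f φ (c Vec.∷ κ)) (allVecs M N)) ⟩
      ∑[ c < M ] Σᴸ.listSum (λ κ → weight f φ (c Vec.∷ κ)) (allVecs M N)
        ≈⟨ sum-cong-≋ (λ c → trans (Σᴸ.listSum-cong (allVecs M N) (weight-∷ c))
             (sym (*-distribˡ-listSum (φ (f 0) c) (weight (f ∘ suc) (φ′ c)) (allVecs M N)))) ⟩
      ∑[ c < M ] (φ (f 0) c * Σᴸ.listSum (weight (f ∘ suc) (φ′ c)) (allVecs M N))
        ≈⟨ sum-cong-≋ (λ c → *-congˡ
             (listSum-allVecs M N (f ∘ suc) (φ′ c) (λ a≤b → backward (ℕ.s≤s a≤b)))) ⟩
      Z M φ (applyUpTo f (suc N)) ∎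
      where
      weight : ∀ {N} → (ℕ → ℕ) → (ℕ → Fin M → Carrier) → Vec (Fin M) N → Carrier
      weight f φ κ = product (λ v → φ (f (toℕ v)) (lookup κ v)) * edgeProduct f κ

      φ′ : Fin M → ℕ → Fin M → Carrier
      φ′ c u d = φ u d * edgeWeight (E (f 0) u) (toℕ c) (toℕ d)

      noEdge : ∀ {a b} c d → a ≤ b → edgeWeight (E (f b) (f a)) c d ≈ 1#
      noEdge c d a≤b rewrite backward a≤b = refl

      weight-∷ : ∀ c κ → weight f φ (c Vec.∷ κ) ≈ φ (f 0) c * weight (f ∘ suc) (φ′ c) κ
      weight-∷ c κ = begin
        (φ (f 0) c * product φs) * ((e₀ * product es) * product (λ a → e a * ees a))
          ≈⟨ *-congˡ (*-cong (*-congʳ (noEdge (toℕ c) (toℕ c) ℕ.≤-refl)) (trans (Π.∑-distrib-+ e ees)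
               (*-congʳ (product-one e (λ a → noEdge (toℕ (lookup κ a)) (toℕ c) ℕ.z≤n))))) ⟩
        (φ (f 0) c * product φs) * ((1# * product es) * (1# * product ees))
          ≈⟨ solve 4 (λ a b c d → (a :* b) :* ((con 1 :* c) :* (con 1 :* d)) := a :* ((b :* c) :* d))
               refl _ _ _ _ ⟩
        φ (f 0) c * (product φs * product es * product ees)
          ≈⟨ *-congˡ (*-congʳ (Π.∑-distrib-+ φs es)) ⟨
        φ (f 0) c * weight (f ∘ suc) (φ′ c) κ ∎
        where
        e₀ = edgeWeight (E (f 0) (f 0)) (toℕ c) (toℕ c)
        φs es e ees : Fin N → Carrier
        φs v = φ (f (suc (toℕ v))) (lookup κ v)
        es v = edgeWeight (E (f 0) (f (suc (toℕ v)))) (toℕ c) (toℕ (lookup κ v))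
        e a = edgeWeight (E (f (suc (toℕ a))) (f 0)) (toℕ (lookup κ a)) (toℕ c)
        ees a = product λ b → edgeWeight (E (f (suc (toℕ a))) (f (suc (toℕ b))))
          (toℕ (lookup κ a)) (toℕ (lookup κ b))

  module _ (N : ℕ) {n m} (μ : Partition n m) {M : ℕ} (x : Fin M → Carrier) where
    open Graph N μ
    open OfGraph (edge N μ)

    -- The monomial of a colouring.
    term : Coloring M → Carrier
    term κ = q ^ asc κ * product (λ v → x (lookup κ v))

    -- This is q ^ asc κ if κ is proper, and 0 otherwise.
    edges : Coloring M → Carrier
    edges = edgeProduct (edge N μ) id

    edges-proper : ∀ {κ : Coloring M} → Proper κ → q ^ asc κ ≈ edges κ
    edges-proper {κ} proper = begin
      q ^ asc κ
        ≈⟨ ^-length-filter ascent? (cartesianProduct (allFin N) (allFin N)) ⟩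
      prod (λ p → qIf (does (ascent? p))) (cartesianProduct (allFin N) (allFin N))
        ≈⟨ Πᴸ.listSum-square N (λ p → qIf (does (ascent? p))) ⟩
      product (λ a → product (λ b → qIf (does (ascent? (a , b)))))
        ≈⟨ Π.sum-cong-≋ (λ a → Π.sum-cong-≋ (λ b →
             edgeWeight-≢ (edge? a b) (λ ab eq → proper a b ab (toℕ-injective eq)))) ⟨
      edges κ ∎
      where
      ascent? : ∀ ((a , b) : Fin N × Fin N) → Dec (Edge a b × toℕ (lookup κ a) < toℕ (lookup κ b))
      ascent? (a , b) = edge? a b ×-dec (toℕ (lookup κ a) ℕ.<? toℕ (lookup κ b))

    edges-improper : ∀ {κ : Coloring M} → ¬ Proper κ → edges κ ≈ 0#
    edges-improper {κ} improper
      with a , improperₐ ← ¬∀⟶∃¬ N _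
             (λ a → all? λ b → edge? a b →-dec ¬? (lookup κ a ≟ᶠ lookup κ b)) improper
      with b , improper₂ ← ¬∀⟶∃¬ N _ (λ b → edge? a b →-dec ¬? (lookup κ a ≟ᶠ lookup κ b)) improperₐ
      = product-zero _ a (product-zero _ b (edgeWeight-zero (edge? a b)
          (decidable-stable (edge? a b) (λ ¬ab → improper₂ (λ ab → contradiction ab ¬ab)))
          (≡.cong toℕ (decidable-stable (lookup κ a ≟ᶠ lookup κ b) (λ ≢ → improper₂ (λ _ → ≢))))))

    proper-term : ∀ κ → (if does (proper? κ) then term κ else 0#) ≈
      product (λ v → x (lookup κ v)) * edges κ
    proper-term κ = byCases (proper? κ)
      (λ proper → trans (*-comm _ _) (*-congˡ (edges-proper {κ} proper)))
      (λ improper → sym (trans (*-congˡ (edges-improper {κ} improper)) (zeroʳ _)))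
      where
      byCases : ∀ {p} {P : Set p} (p? : Dec P) {a b} → (P → a ≈ b) → (¬ P → 0# ≈ b) →
        (if does p? then a else 0#) ≈ b
      byCases (yes p) a≈b 0≈b = a≈b p
      byCases (no ¬p) a≈b 0≈b = 0≈b ¬p

    -- The left-hand side is the chromatic polynomial, with arbitrary q and x in place of
    -- the variables.
    chromatic-Z : foldr _+_ 0# (map term (filter proper? (allVecs M N))) ≈ Z M (λ _ → x) (upTo N)
    chromatic-Z = begin
      foldr _+_ 0# (map term (filter proper? (allVecs M N)))
        ≈⟨ Σᴸ.foldr-filter proper? term (allVecs M N) ⟩
      Σᴸ.listSum (λ κ → if does (proper? κ) then term κ else 0#) (allVecs M N)
        ≈⟨ Σᴸ.listSum-cong (allVecs M N) proper-term ⟩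
      Σᴸ.listSum (λ κ → product (λ v → x (lookup κ v)) * edgeProduct (edge N μ) id κ) (allVecs M N)
        ≈⟨ listSum-allVecs (edge N μ) M N id (λ _ → x) (edge-backward N μ) ⟩
      Z M (λ _ → x) (upTo N) ∎

-- Expansion along the class of the smallest colour

module Recurrence {c ℓ} (R : CommutativeRing c ℓ) (q : CommutativeRing.Carrier R) where

  open CommutativeRing R hiding (zero)
  open SemiringSum semiring
  open SemiringExp semiring
  open SemiringSolver commutativeSemiring using (solve; _:*_; _:=_; con)
  open SetoidReasoning setoid
  open Splits R
  open Colourings R q

  module _ {n m : ℕ} (μ : Partition n m) where

    private
      N = m ℕ.+ n

    open OfGraph (edge N μ)
    open RangeSum +-commutativeMonoid using (sum-ε; sum-columns-rows; sum-truncate)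

    -- The number of edges from v to later vertices.
    deg : ℕ → ℕ
    deg v = N ∸ suc v ∸ conjugate μ v

    qEdges-degree : ∀ v → prod (λ b → qIf (edge N μ v b)) (upTo N) ≈ q ^ deg v
    qEdges-degree v = trans (prod-qIf (edge N μ v) (upTo N)) (^-congʳ q
      (≡.trans (ListSum.listSum-applyUpTo ℕ.+-0-commutativeMonoid (λ b → bit (edge N μ v b)) id N)
               (degree μ v)))

    -- All later vertices are adjacent to the vertex of row i.
    deg-row : ∀ i → deg (m ℕ.+ toℕ (opposite i)) ≡ toℕ i
    deg-row i = ≡.cong₂ _∸_ rest none
      where
      v = m ℕ.+ toℕ (opposite i)
      rest : N ∸ suc v ≡ toℕ i
      rest = ≡.trans (≡.cong (_∸ suc v) (≡.trans (≡.sym (m+opposite m i)) (ℕ.+-suc v (toℕ i))))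
        (ℕ.m+n∸m≡n (suc v) (toℕ i))
      none : conjugate μ v ≡ 0
      none = ≡.cong length (List.filter-none (λ i → v ℕ.<? part μ i)
        (All.tabulate⁺ (λ i v<μᵢ → ℕ.<⇒≱ v<μᵢ (ℕ.≤-trans (bounded μ i) (ℕ.m≤m+n m _)))))

    upTo-sorted : AllPairs (λ a b → a < b × b < N) (upTo N)
    upTo-sorted = AllPairs.applyUpTo⁺₁ id N (λ i<j j<N → i<j , j<N)

    -- The classes A are empty, a vertex, or the two vertices of a cell, and for each the
    -- vertices outside A are enumerated by punch.
    addBottom-expand : ∀ x f → addBottom x f (upTo N) ≈
      f (upTo N)
        + x * ∑[ i < N ] (q ^ deg (toℕ i) * f (applyUpTo (punch (toℕ i)) (N ∸ 1)))
        + x ^ 2 * ∑[ i < n ] (∑[ j < part μ i ] (q ^ (toℕ i ℕ.+ deg (toℕ j)) *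
            f (applyUpTo (punch (m ℕ.+ toℕ (opposite i)) ∘ punch (toℕ j)) (N ∸ 2))))
    addBottom-expand x f = begin
      addBottom x f (upTo N)
        ≈⟨ addBottom-total (edge-isAbelian μ) x f upTo-sorted ⟩
      splitSum (upTo N) g
        ≈⟨ splitSum-≤2 N id g (λ sp → trans (*-congʳ (classWeight-triple (edge-isAbelian μ) (λ _ → x)
             (proj₁ (AllPairs-split sp upTo-sorted)))) (zeroˡ _)) ⟩
      g [] (upTo N)
        + ∑[ i < N ] g (toℕ i ∷ []) (applyUpTo (punch (toℕ i)) (N ∸ 1))
        + ∑[ v < N ] pairs (toℕ v)
        ≈⟨ +-cong (+-cong (trans (*-identityˡ _) (*-identityˡ _))
             (trans (sum-cong-≋ {N} (λ i → single (toℕ i) _)) (sym (*-distribˡ-sum {N} x _))))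
             (trans (sum-columns-rows m n pairs) (trans (+-congʳ columns) (+-identityˡ _))) ⟩
      f (upTo N)
        + x * ∑[ i < N ] (q ^ deg (toℕ i) * f (applyUpTo (punch (toℕ i)) (N ∸ 1)))
        + ∑[ i < n ] pairs (row i)
        ≈⟨ +-congˡ (trans (sum-cong-≋ {n} rows) (sym (*-distribˡ-sum {n} (x ^ 2) _))) ⟩
      f (upTo N)
        + x * ∑[ i < N ] (q ^ deg (toℕ i) * f (applyUpTo (punch (toℕ i)) (N ∸ 1)))
        + x ^ 2 * ∑[ i < n ] (∑[ j < part μ i ] (q ^ (toℕ i ℕ.+ deg (toℕ j)) *
            f (applyUpTo (punch (row i) ∘ punch (toℕ j)) (N ∸ 2)))) ∎
      where
      g : List ℕ → List ℕ → Carrier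
      g A B = classWeight (λ _ → x) A * (qEdges A (upTo N) * f B)

      row : Fin n → ℕ
      row i = m ℕ.+ toℕ (opposite i)

      pair : ℕ → ℕ → Carrier
      pair v u = g (u ∷ v ∷ []) (applyUpTo (punch v ∘ punch u) (N ∸ 2))

      pairs : ℕ → Carrier
      pairs v = ∑[ u < v ] pair v (toℕ u)

      single : ∀ v B → g (v ∷ []) B ≈ x * (q ^ deg v * f B)
      single v B = trans (*-congˡ (*-congʳ (*-congʳ (qEdges-degree v))))
        (solve 3 (λ x e p → x :* (con 1 :* con 1) :* (e :* con 1 :* p) := x :* (e :* p)) refl _ _ _)

      -- Adjacent vertices do not share a colour.
      pair-edge : ∀ {u v} → edge N μ u v ≡ true → pair v u ≈ 0#
      pair-edge {u} {v} eq rewrite eq = solve 3 (λ x y z →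
        x :* ((con 0 :* con 1) :* y) :* z := con 0) refl _ _ _

      edge-true : ∀ {u v} → u < v → ¬ NonEdgeℕ N μ u v → edge N μ u v ≡ true
      edge-true {u} {v} u<v ¬ne = dec-true (edgeℕ? N μ u v) (u<v , ¬ne)

      -- Two column vertices are adjacent.
      columns : ∑[ v < m ] pairs (toℕ v) ≈ 0#
      columns = sum-ε (λ v → sum-ε (λ u → pair-edge (edge-true (toℕ<n u)
        (λ ne → ℕ.<⇒≱ (toℕ<n v) (nonEdge-row μ ne)))))

      -- The vertices not adjacent to that of row i are the columns j < part μ i.
      rows : ∀ i → pairs (row i) ≈ x ^ 2 * ∑[ j < part μ i ] (q ^ (toℕ i ℕ.+ deg (toℕ j)) *
        f (applyUpTo (punch (row i) ∘ punch (toℕ j)) (N ∸ 2)))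
      rows i = begin
        pairs (row i)
          ≈⟨ sum-truncate (pair (row i)) (ℕ.≤-trans (bounded μ i) (ℕ.m≤m+n m _))
               (λ {u} μᵢ≤u u<v → pair-edge (edge-true u<v
                 (λ ne → ℕ.<⇒≱ (Equivalence.to (nonEdge-⇔ i) ne) μᵢ≤u))) ⟩
        ∑[ j < part μ i ] pair (row i) (toℕ j)
          ≈⟨ sum-cong-≋ (λ j → cell (toℕ j) (toℕ<n j)) ⟩
        ∑[ j < part μ i ] (x ^ 2 * (q ^ (toℕ i ℕ.+ deg (toℕ j)) * rest (toℕ j)))
          ≈⟨ *-distribˡ-sum {part μ i} (x ^ 2) _ ⟨
        x ^ 2 * ∑[ j < part μ i ] (q ^ (toℕ i ℕ.+ deg (toℕ j)) * rest (toℕ j)) ∎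
        where
        rest : ℕ → Carrier
        rest j = f (applyUpTo (punch (row i) ∘ punch j) (N ∸ 2))
        nonEdge-⇔ = nonEdge-opposite μ
        cell : ∀ j → j < part μ i → pair (row i) j ≈ x ^ 2 * (q ^ (toℕ i ℕ.+ deg j) * rest j)
        cell j j<μᵢ
          rewrite nonEdge⇒edge-false μ {N} {j} {row i} (Equivalence.from (nonEdge-⇔ i) j<μᵢ) = begin
          x * (1# * 1# * (x * (1# * 1#))) *
            (prod (λ b → qIf (edge N μ j b)) (upTo N) *
              (prod (λ b → qIf (edge N μ (row i) b)) (upTo N) * 1#) * rest j)
            ≈⟨ *-congˡ (*-congʳ (*-cong (qEdges-degree j) (*-congʳ
                 (trans (qEdges-degree (row i)) (^-congʳ q (deg-row i)))))) ⟩
          x * (1# * 1# * (x * (1# * 1#))) * (q ^ deg j * (q ^ toℕ i * 1#) * rest j)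
            ≈⟨ solve 4 (λ x d e p → x :* (con 1 :* con 1 :* (x :* (con 1 :* con 1))) :* (d :* (e :* con 1) :* p)
                 := x :* (x :* con 1) :* (e :* d :* p)) refl _ _ _ _ ⟩
          x ^ 2 * (q ^ toℕ i * q ^ deg j * rest j)
            ≈⟨ *-congˡ (*-congʳ (^-homo-* q (toℕ i) (deg j))) ⟨
          x ^ 2 * (q ^ (toℕ i ℕ.+ deg j) * rest j) ∎

    -- The largest colour is treated as if it were the smallest one.
    Z-recurrence : ∀ M (xs : Fin (suc M) → Carrier) →
      Z (suc M) (λ _ → xs) (upTo N) ≈ addBottom (xs (fromℕ M)) (Z M (λ _ → xs ∘ inject₁)) (upTo N)
    Z-recurrence M xs = trans (Z-top (edge-isAbelian μ) M (λ _ → xs) upTo-sorted)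
      (sym (addBottom-Z (edge-isAbelian μ) (xs (fromℕ M)) M (xs ∘ inject₁) upTo-sorted))

-- The inclusion of polynomial rings and the recurrence for chromatic polynomials

module Inclusion (M : ℕ) where
  private
    module L = ℤ[q,x] M
    module H = ℤ[q,x] (suc M)
    module CL = Colourings (ℤ[q,x]-ring M) L.q
    module CH = Colourings (ℤ[q,x]-ring (suc M)) H.q
  open Polynomial (ℤ[q,x]-ring M) using (coeffwise)

  ι-cong : ∀ {a b} → a L.≈ b → ι M a H.≈ ι M b
  ι-cong e = coeffwise λ { zero → e ; (suc k) → L.refl }

  ι-0 : ι M L.0# H.≈ H.0#
  ι-0 = coeffwise λ { zero → L.refl ; (suc k) → L.refl }

  ι-* : ∀ a b → ι M (a L.* b) H.≈ ι M a H.* ι M b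
  ι-* a b = coeffwise λ { zero → L.sym (L.+-identityʳ _) ; (suc k) → L.refl }

  ι-sum : ∀ {n} (f : Fin n → L.Carrier) → ι M (L.sum f) H.≈ H.sum (ι M ∘ f)
  ι-sum {zero}  f = ι-0
  ι-sum {suc n} f = H.+-congˡ {ι M (f zero)} (ι-sum (f ∘ suc))

  ι-edgeWeight : ∀ e c d → ι M (CL.edgeWeight e c d) H.≈ CH.edgeWeight e c d
  ι-edgeWeight false c d = H.refl
  ι-edgeWeight true  c d with does (c ℕ.≟ d) | does (c ℕ.<? d)
  ... | true  | _     = ι-0
  ... | false | true  = H.refl
  ... | false | false = H.refl

  ι-Z : ∀ {V : Set} (E : V → V → Bool) K φ S →
    ι M (CL.OfGraph.Z E K φ S) H.≈ CH.OfGraph.Z E K (λ v c → ι M (φ v c)) S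
  ι-Z E K φ []      = H.refl
  ι-Z E K φ (v ∷ S) = H.trans (ι-sum {K} _) (sum-cong-≋ {K} (λ c → H.trans (ι-* _ _)
    (H.*-congˡ {ι M (φ v c)} (H.trans (ι-Z E K _ S) (CH.OfGraph.Z-cong E K S (λ u d → H.trans (ι-* _ _)
      (H.*-congˡ {ι M (φ u d)} (ι-edgeWeight (E v u) (toℕ c) (toℕ d)))))))))
    where open import Algebra.Properties.CommutativeMonoid.Sum H.+-commutativeMonoid using (sum-cong-≋)

x-inject₁ : ∀ M c → x-var (suc M) (inject₁ c) ≡ ι M (x-var M c)
x-inject₁ M c rewrite view-inject₁ c = ≡.refl

module _ (M : ℕ) where
  open ℤ[q,x] (suc M)
  open SetoidReasoning setoid
  open Colourings (ℤ[q,x]-ring (suc M)) q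
  open Recurrence (ℤ[q,x]-ring (suc M)) q
  private
    -- The first M of the M + 1 variables.
    xs : Fin M → Carrier
    xs c = x (inject₁ c)

  open OfGraph

  ι-X : ∀ N {n m} (μ : Partition n m) → Z (edge N μ) M (λ _ → xs) (upTo N) ≈ ι M (X M N μ)
  ι-X N μ = begin
    Z (edge N μ) M (λ _ → xs) (upTo N)
      ≈⟨ Z-cong (edge N μ) M (upTo N) (λ _ c → reflexive (x-inject₁ M c)) ⟩
    Z (edge N μ) M (λ _ c → ι M (x-var M c)) (upTo N)
      ≈⟨ Inclusion.ι-Z M (edge N μ) M (λ _ → x-var M) (upTo N) ⟨
    ι M (Colourings.OfGraph.Z (ℤ[q,x]-ring M) (q-var M) (edge N μ) M (λ _ → x-var M) (upTo N))
      ≈⟨ Inclusion.ι-cong M (Chromatic.chromatic-Z (ℤ[q,x]-ring M) (q-var M) N μ (x-var M)) ⟨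
    ι M (X M N μ) ∎

  module _ {n m : ℕ} (μ : Partition n m) where
    private
      N = m ℕ.+ n

      -- The polynomial in the first M variables of the induced subgraphs of G(μ).
      P : List ℕ → Carrier
      P = Z (edge N μ) M (λ _ → xs)

    -- If f embeds the graph of ν into that of μ, then the colourings of its image are
    -- those of the graph of ν.
    P-delete : ∀ {n′ m′} (ν : Partition n′ m′) N′ f →
      (∀ a b → edge N μ (f a) (f b) ≡ edge N′ ν a b) → P (applyUpTo f N′) ≈ ι M (X M N′ ν)
    P-delete ν N′ f e = trans
      (Z-relabel (edge N μ) (edge N′ ν) M N′ f id e (λ _ _ → refl)) (ι-X N′ ν)

    P-vertex : ∀ (i : Fin N) →
      P (applyUpTo (punch (toℕ i)) (N ∸ 1)) ≈ ι M (X M (N ∸ 1) (proj₂ (proj₂ (μ / i))))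
    P-vertex i with splitAt m i in eq
    ... | inj₁ j = P-delete (removeColumn μ j) (N ∸ 1) (punch (toℕ i)) (λ a b →
      ≡.subst (λ v → edge N μ (punch v a) (punch v b) ≡ edge (N ∸ 1) (removeColumn μ j) a b)
        (≡.trans (≡.sym (toℕ-↑ˡ j n)) (≡.cong toℕ (splitAt⁻¹-↑ˡ eq)))
        (edge-removeColumn μ j a b))
    ... | inj₂ k = P-delete (removeRow μ (opposite k)) (N ∸ 1) (punch (toℕ i)) (λ a b →
      edge-removeRow μ (opposite k) N (toℕ i)
        (≡.subst (m ≤_) i≡ (ℕ.m≤m+n m _))
        (≡.trans (≡.cong (ℕ._+ _) (≡.trans (≡.sym i≡)
                   (≡.cong (λ k → m ℕ.+ toℕ k) (≡.sym (opposite-involutive k)))))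
          (m+opposite m (opposite k)))
        a b)
      where
      i≡ : m ℕ.+ toℕ k ≡ toℕ i
      i≡ = ≡.trans (≡.sym (toℕ-↑ʳ m k)) (≡.cong toℕ (splitAt⁻¹-↑ʳ eq))

    P-cell : ∀ (i : Fin n) (j : Fin (part μ i)) →
      P (applyUpTo (punch (m ℕ.+ toℕ (opposite i)) ∘ punch (toℕ j)) (N ∸ 2)) ≈
      ι M (X M (N ∸ 2) (μ /cell[ i , j ]))
    P-cell i j = P-delete (μ /cell[ i , j ]) (N ∸ 2) _ (λ a b → ≡.trans
      (edge-removeRow μ i N _ (ℕ.m≤m+n m _) (m+opposite m i) (punch (toℕ j) a) (punch (toℕ j) b))
      (≡.trans
        (≡.cong₂ (λ K v → edge K (removeRow μ i) (punch v a) (punch v b))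
          (N-1 i) (≡.sym (toℕ-inject≤ j (bounded μ i))))
        (≡.trans (edge-removeColumn (removeRow μ i) (inject≤ j (bounded μ i)) a b)
          (≡.cong (λ K → edge K (μ /cell[ i , j ]) a b)
            (≡.trans (≡.cong (_∸ 1) (≡.sym (N-1 i))) (ℕ.∸-+-assoc N 1 1))))))
      where
      N-1 : ∀ {n} (i : Fin n) → m ℕ.+ n ∸ 1 ≡ m ℕ.+ ℕ.pred n
      N-1 {suc n} i = ≡.cong (_∸ 1) (ℕ.+-suc m n)

lemma3p2 : ∀ (m n : ℕ) → n ≤ m → ∀ (M : ℕ) (μ : Partition n m) →
    let open ℤ[q,x] (suc M)
        N  = m ℕ.+ n
        xM = x (fromℕ M)
    in
      X (suc M) N μ
        ≈ ι M (X M N μ)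
          + xM * (∑[ i < N ]
              (let (_ , _ , μ/i) = μ / i in
               q ^ (N ∸ suc (toℕ i) ∸ conjugate μ (toℕ i)) * ι M (X M (N ∸ 1) μ/i)))
          + xM ^ 2 * (∑[ i < n ] (∑[ j < part μ i ]
              (q ^ (toℕ i ℕ.+ (N ∸ suc (toℕ j) ∸ conjugate μ (toℕ j)))
                * ι M (X M (N ∸ 2) (μ /cell[ i , j ])))))
lemma3p2 m n _ M μ = begin
  X (suc M) N μ
    ≈⟨ Chromatic.chromatic-Z (ℤ[q,x]-ring (suc M)) q N μ x ⟩
  Z (edge N μ) (suc M) (λ _ → x) (upTo N)
    ≈⟨ Z-recurrence μ M x ⟩
  addBottom (edge N μ) (x (fromℕ M)) (Z (edge N μ) M (λ _ → x ∘ inject₁)) (upTo N)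
    ≈⟨ addBottom-expand μ (x (fromℕ M)) _ ⟩
  _
    ≈⟨ +-cong (+-cong (ι-X M N μ)
         (*-congˡ {x (fromℕ M)} (sum-cong-≋ {N} (λ i → *-congˡ {q ^ deg μ (toℕ i)} (P-vertex M μ i)))))
         (*-congˡ {x (fromℕ M) ^ 2} (sum-cong-≋ {n} (λ i → sum-cong-≋ {part μ i} (λ j →
           *-congˡ {q ^ (toℕ i ℕ.+ deg μ (toℕ j))} (P-cell M μ i j))))) ⟩
  _ ∎
  where
  open ℤ[q,x] (suc M)
  open SetoidReasoning setoid
  open Colourings (ℤ[q,x]-ring (suc M)) q
  open Recurrence (ℤ[q,x]-ring (suc M)) q
  open OfGraph
  open import Algebra.Properties.CommutativeMonoid.Sum +-commutativeMonoid using (sum-cong-≋)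
  N = m ℕ.+ n
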